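{- For every prime $p\geq 5$, $$\sum_{k=0}^{p-1}(2k+1)^3A_k\equiv p^3+4p^4H_{p-1}+\frac{6}{5}p^8B_{p-5}\pmod{p^9},$$ where $A_k=\sum_{j=0}^{k}\binom{k+j}{j}^2\binom{k}{j}^2$ is the $k$-th Apéry number, $H_{p-1}=\sum_{j=1}^{p-1}\frac1j$, and $B_{p-5}$ is a Bernoulli number.
   Context: The Bernoulli numbers are defined by $B_0=1$ and $\sum_{k=0}^{n-1}\binom{n}{k}B_k=0$ for $n\geq 2$. Congruences between rational numbers modulo a power of $p$ are understood in the ring of rationals whose denominators are prime to $p$. -}

module Defs where

open import Data.Nat as ℕ using (ℕ; zero; suc)
open import Data.Nat.Combinatorics using (_C_)
open import Data.Nat.Coprimality using (Coprime)
open import Data.Integer as ℤ using (ℤ)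
open import Data.Rational as ℚ using (ℚ; 0ℚ; 1ℚ; _+_; _*_; _-_; -_; ↧ₙ_)
open import Data.List using (List; []; _∷_; _++_; [_]; upTo; map; foldr; zip; length)
open import Data.Product using (Σ; _×_)
open import Relation.Binary.PropositionalEquality using (_≡_)

ℕ→ℚ : ℕ → ℚ
ℕ→ℚ n = ℤ.+ n ℚ./ 1

Σ< : ℕ → (ℕ → ℚ) → ℚ
Σ< zero    f = 0ℚ
Σ< (suc n) f = Σ< n f + f n

-- Bernoulli numbers B_0..B_n as a list, using
-- B_n = -(1/(n+1)) * Σ_{k<n} C(n+1,k) B_k   (equivalent to Σ_{k=0}^{m-1} C(m,k) B_k = 0, m = n+1 ≥ 2)
private
  wsum : ℕ → ℕ → List ℚ → ℚ
  wsum m i []       = 0ℚ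
  wsum m i (b ∷ bs) = ℕ→ℚ (m C i) * b + wsum m (suc i) bs

bernoulliList : ℕ → List ℚ
bernoulliList zero    = [ 1ℚ ]
bernoulliList (suc n) =
  let bs = bernoulliList n in
  bs ++ [ - (wsum (suc (suc n)) 0 bs * (ℤ.+ 1 ℚ./ suc (suc n))) ]

lastOr : List ℚ → ℚ
lastOr []           = 0ℚ
lastOr (x ∷ [])     = x
lastOr (x ∷ y ∷ xs) = lastOr (y ∷ xs)

-- B n : the n-th Bernoulli number (B_0 = 1, B_1 = -1/2)
B : ℕ → ℚ
B n = lastOr (bernoulliList n)

apery : ℕ → ℕ
apery k = go (suc k)
  where
  go : ℕ → ℕ
  go zero    = 0
  go (suc j) = go j ℕ.+ ((k ℕ.+ j) C j) ℕ.^ 2 ℕ.* (k C j) ℕ.^ 2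

H : ℕ → ℚ
H zero    = 0ℚ
H (suc n) = H n + (ℤ.+ 1 ℚ./ suc n)

-- congruence of rationals modulo m (in the ring of rationals whose denominators are prime to p):
-- x ≡ y (mod m) iff x - y = m * r with r a rational whose (reduced) denominator is coprime to p
CongMod : (p : ℕ) → ℚ → ℚ → ℚ → Set
CongMod p m x y = Σ ℚ (λ r → Coprime (↧ₙ r) p × (x - y ≡ m * r))

{-# OPTIONS --safe #-}

-- With w_j = ∏_{i≤j} (n²/i² - 1), telescoping first in k and then in j gives the exact identity
--   Σ_{k<n} (2k+1)³ A_k = n⁶ Σ_{j<n} w_j² / (j+1)³.
-- For n = p prime, expanding w_j² in powers of p expresses the sum modulo p⁹ through the power sums
-- h_e = Σ_{0<j<p} j⁻ᵉ and Z = Σ_{0<i<j<p} i⁻² j⁻³.  The reflection j ↦ p - j relates h₁, h₃, h₄, h₅,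
-- and everything reduces to  5 h₄ ≡ 4 p B_{p-5} (mod p²)  and  Z ≡ -2 B_{p-5} (mod p).
-- The second follows from Faulhaber's formula.  For the first, write h₄ and Σ_{j<p} j^{p-5} ≡ p B_{p-5}
-- modulo p² both as multiples of p Σ_{j<p/2} j⁻⁵, by folding the range onto its lower half in two ways;
-- this divides by 2⁴ - 1 = 15, so p = 5 is checked separately.

module Submission where

open import Defs
open import Data.Nat as ℕ using (ℕ; zero; suc; _≥_; _∸_; z≤n; s≤s) renaming (_^_ to _ℕ^_)
import Data.Nat.Properties as ℕ
open import Data.Nat.Combinatorics using (_C_; nCk+nC[k+1]≡[n+1]C[k+1]; k>n⇒nCk≡0; nCn≡1)
open import Data.Nat.Coprimality as Coprimality using (Coprime; coprime?; coprime-divisor)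
open import Data.Nat.Divisibility using (_∣_; divides; ∣-trans; ∣⇒≤)
open import Data.Nat.Primality using (Prime; euclidsLemma; prime⇒irreducible; prime⇒nonTrivial)
open import Data.Nat.Tactic.RingSolver using () renaming (solve-∀ to ℕ-solve-∀)
open import Data.Integer as ℤ using (ℤ; +_)
import Data.Integer.Properties as ℤ
open import Data.List using (List; []; _∷_; _++_; [_]; length)
open import Data.List.Properties using (length-++)
open import Data.Rational using (ℚ; 0ℚ; 1ℚ; _+_; _*_; _-_; -_; _/_; toℚᵘ; ↧ₙ_; ↥_; ↧_; mkℚ)
open import Data.Rational.Properties as ℚ using (+-*-commutativeRing; _≟_; toℚᵘ-injective)
open import Data.Rational.Unnormalised as ℚᵘ using (mkℚᵘ; *≡*)
import Data.Rational.Unnormalised.Properties as ℚᵘ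
open import Data.Product using (∃; _,_)
open import Data.Sum using (_⊎_; inj₁; inj₂)
open import Function using (_∘_)
open import Relation.Binary.PropositionalEquality using (_≡_; refl; sym; trans; cong; cong₂; subst; module ≡-Reasoning)
open import Relation.Nullary using (¬_; contradiction)
open import Relation.Nullary.Decidable using (dec⇒maybe; toWitness)
open import Tactic.RingSolver using (solve-∀)
open import Tactic.RingSolver.Core.AlmostCommutativeRing using (AlmostCommutativeRing; fromCommutativeRing)

-- The number n enters w_j only through n², so for n = p the expansion of w_j² runs in powers of p².
-- The prefactor p⁶ does not act evenly: the summand with j + 1 = p contains p⁻³ and contributes
-- p³w², so w² is expanded modulo p⁶ there, whereas the other summands keep the full p⁶. The
-- accuracy demanded of a power sum falls with the power of p in front of it: h₂ matters modulo p⁴,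
-- h₃ modulo p³, h₄ modulo p², and h₅ and Z modulo p. The obstacle is h₄. Fermat's j⁻⁴ ≡ j^(p-5)
-- holds only modulo p, so Faulhaber's formula does not reach h₄ modulo p² directly. Reflection is
-- silent too: for an even exponent the leading terms agree instead of being opposite, and h₄
-- cancels from the relation. Folding helps because it writes both h₄ and the sum of j^(p-5) as p
-- times a sum over the lower half, and that half sum matters only modulo p, where Fermat's theorem
-- suffices.

ℚ-ring : AlmostCommutativeRing _ _
ℚ-ring = fromCommutativeRing +-*-commutativeRing (λ x → dec⇒maybe (0ℚ ≟ x))

-- In this module _^_ is the power of rationals, as the ring solver knows it, and _ℕ^_ that of naturals.
module _ where
  open AlmostCommutativeRing ℚ-ring using (_^_)

  -- Powers, integers and reciprocals in ℚ

  ^-suc : ∀ x n → x ^ suc n ≡ x * x ^ n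
  ^-suc x zero    = sym (ℚ.*-identityʳ x)
  ^-suc x (suc n) = ℚ.*-comm (x ^ suc n) x

  int : ℤ → ℚ
  int z = z / 1

  toℚᵘ-int : ∀ z → toℚᵘ (int z) ℚᵘ.≃ mkℚᵘ z 0
  toℚᵘ-int z = ℚ.toℚᵘ-fromℚᵘ (mkℚᵘ z 0)

  int-+ : ∀ a b → int (a ℤ.+ b) ≡ int a + int b
  int-+ a b = toℚᵘ-injective (ℚᵘ.≃-trans (toℚᵘ-int (a ℤ.+ b)) (ℚᵘ.≃-trans (*≡* eq)
    (ℚᵘ.≃-sym (ℚᵘ.≃-trans (ℚ.toℚᵘ-homo-+ (int a) (int b)) (ℚᵘ.+-cong (toℚᵘ-int a) (toℚᵘ-int b))))))
    where
    eq : (a ℤ.+ b) ℤ.* + 1 ≡ (a ℤ.* + 1 ℤ.+ b ℤ.* + 1) ℤ.* + 1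
    eq = cong (ℤ._* + 1) (sym (cong₂ ℤ._+_ (ℤ.*-identityʳ a) (ℤ.*-identityʳ b)))

  int-* : ∀ a b → int (a ℤ.* b) ≡ int a * int b
  int-* a b = toℚᵘ-injective (ℚᵘ.≃-trans (toℚᵘ-int (a ℤ.* b))
    (ℚᵘ.≃-sym (ℚᵘ.≃-trans (ℚ.toℚᵘ-homo-* (int a) (int b)) (ℚᵘ.*-cong (toℚᵘ-int a) (toℚᵘ-int b)))))

  int-neg : ∀ a → int (ℤ.- a) ≡ - int a
  int-neg a = toℚᵘ-injective (ℚᵘ.≃-trans (toℚᵘ-int (ℤ.- a))
    (ℚᵘ.≃-sym (ℚᵘ.≃-trans (ℚ.toℚᵘ-homo‿- (int a)) (ℚᵘ.-‿cong (toℚᵘ-int a)))))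

  int-injective : ∀ {a b} → int a ≡ int b → a ≡ b
  int-injective {a} {b} eq with ℚᵘ.≃-trans (ℚᵘ.≃-sym (toℚᵘ-int a)) (ℚᵘ.≃-trans (ℚᵘ.≃-reflexive (cong toℚᵘ eq)) (toℚᵘ-int b))
  ... | *≡* e = trans (sym (ℤ.*-identityʳ a)) (trans e (ℤ.*-identityʳ b))

  denominator-clears : ∀ r → int (↧ r) * r ≡ int (↥ r)
  denominator-clears r@record{} = toℚᵘ-injective (ℚᵘ.≃-trans (ℚ.toℚᵘ-homo-* (int (↧ r)) r)
    (ℚᵘ.≃-trans (ℚᵘ.*-cong (toℚᵘ-int (↧ r)) ℚᵘ.≃-refl) (ℚᵘ.≃-trans (*≡* eq) (ℚᵘ.≃-sym (toℚᵘ-int (↥ r))))))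
    where
    eq : (↧ r ℤ.* ↥ r) ℤ.* + 1 ≡ ↥ r ℤ.* + (1 ℕ.* ↧ₙ r)
    eq = trans (ℤ.*-identityʳ _) (trans (ℤ.*-comm (↧ r) (↥ r)) (cong (λ d → ↥ r ℤ.* + d) (sym (ℕ.*-identityˡ (↧ₙ r)))))

  ℕ→ℚ-+ : ∀ m n → ℕ→ℚ (m ℕ.+ n) ≡ ℕ→ℚ m + ℕ→ℚ n
  ℕ→ℚ-+ m n = int-+ (+ m) (+ n)

  ℕ→ℚ-* : ∀ m n → ℕ→ℚ (m ℕ.* n) ≡ ℕ→ℚ m * ℕ→ℚ n
  ℕ→ℚ-* m n = trans (cong int (ℤ.pos-* m n)) (int-* (+ m) (+ n))

  ℕ→ℚ-suc : ∀ n → ℕ→ℚ (suc n) ≡ 1ℚ + ℕ→ℚ n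
  ℕ→ℚ-suc n = ℕ→ℚ-+ 1 n

  ℕ→ℚ-^ : ∀ m n → ℕ→ℚ (m ℕ^ n) ≡ ℕ→ℚ m ^ n
  ℕ→ℚ-^ m zero    = refl
  ℕ→ℚ-^ m (suc n) = trans (ℕ→ℚ-* m (m ℕ^ n)) (trans (cong (ℕ→ℚ m *_) (ℕ→ℚ-^ m n)) (sym (^-suc (ℕ→ℚ m) n)))

  -- v n = 1/n, with the junk value v 0 = 0.
  v : ℕ → ℚ
  v zero    = 0ℚ
  v (suc n) = + 1 / suc n

  v-inverse : ∀ n → ℕ→ℚ (suc n) * v (suc n) ≡ 1ℚ
  v-inverse n = toℚᵘ-injective (ℚᵘ.≃-trans (ℚ.toℚᵘ-homo-* (ℕ→ℚ (suc n)) (v (suc n)))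
    (ℚᵘ.≃-trans (ℚᵘ.*-cong (toℚᵘ-int (+ suc n)) (ℚ.toℚᵘ-fromℚᵘ (mkℚᵘ (+ 1) n))) (*≡* eq)))
    where
    eq : (+ suc n ℤ.* + 1) ℤ.* + 1 ≡ + 1 ℤ.* + (1 ℕ.* suc n)
    eq = trans (ℤ.*-identityʳ _) (trans (ℤ.*-identityʳ _) (sym (trans (ℤ.*-identityˡ _) (cong +_ (ℕ.*-identityˡ (suc n))))))

  cancel : ∀ {c u} x → c * u ≡ 1ℚ → u * (c * x) ≡ x
  cancel {c} {u} x cu = trans (lem c u x) (trans (cong (_* x) cu) (ℚ.*-identityˡ x))
    where
    lem : ∀ c u x → u * (c * x) ≡ c * u * x
    lem = solve-∀ ℚ-ring

  -- Finite sums

  Σ-cong : ∀ n {f g} → (∀ i → i ℕ.< n → f i ≡ g i) → Σ< n f ≡ Σ< n g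
  Σ-cong zero    eq = refl
  Σ-cong (suc n) eq = cong₂ _+_ (Σ-cong n λ i i<n → eq i (ℕ.m<n⇒m<1+n i<n)) (eq n (ℕ.n<1+n n))

  Σ-ext : ∀ n {f g} → (∀ i → f i ≡ g i) → Σ< n f ≡ Σ< n g
  Σ-ext n eq = Σ-cong n λ i _ → eq i

  Σ-+ : ∀ n f g → Σ< n (λ i → f i + g i) ≡ Σ< n f + Σ< n g
  Σ-+ zero    f g = refl
  Σ-+ (suc n) f g = trans (cong (_+ (f n + g n)) (Σ-+ n f g)) (lem (Σ< n f) (Σ< n g) (f n) (g n))
    where
    lem : ∀ a b c d → (a + b) + (c + d) ≡ (a + c) + (b + d)
    lem = solve-∀ ℚ-ring

  Σ-*ˡ : ∀ n c f → Σ< n (λ i → c * f i) ≡ c * Σ< n f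
  Σ-*ˡ zero    c f = sym (ℚ.*-zeroʳ c)
  Σ-*ˡ (suc n) c f = trans (cong (_+ c * f n) (Σ-*ˡ n c f)) (sym (ℚ.*-distribˡ-+ c (Σ< n f) (f n)))

  Σ-zero : ∀ n → Σ< n (λ _ → 0ℚ) ≡ 0ℚ
  Σ-zero zero    = refl
  Σ-zero (suc n) = trans (ℚ.+-identityʳ _) (Σ-zero n)

  Σ-swap : ∀ m n (f : ℕ → ℕ → ℚ) → Σ< m (λ i → Σ< n (f i)) ≡ Σ< n (λ j → Σ< m (λ i → f i j))
  Σ-swap zero    n f = sym (Σ-zero n)
  Σ-swap (suc m) n f = trans (cong (_+ Σ< n (f m)) (Σ-swap m n f)) (sym (Σ-+ n _ (f m)))

  Σ-head : ∀ n f → Σ< (suc n) f ≡ f 0 + Σ< n (f ∘ suc)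
  Σ-head zero    f = trans (ℚ.+-identityˡ (f 0)) (sym (ℚ.+-identityʳ (f 0)))
  Σ-head (suc n) f = trans (cong (_+ f (suc n)) (Σ-head n f)) (ℚ.+-assoc (f 0) _ _)

  Σ-reverse : ∀ n (f : ℕ → ℚ) → Σ< n (f ∘ suc) ≡ Σ< n (λ i → f (n ∸ i))
  Σ-reverse zero    f = refl
  Σ-reverse (suc n) f = trans (ℚ.+-comm (Σ< n (f ∘ suc)) (f (suc n)))
    (trans (cong (_+_ (f (suc n))) (Σ-reverse n f)) (sym (Σ-head n (λ i → f (suc n ∸ i)))))

  Σ-telescope : ∀ n f (g : ℕ → ℚ) → (∀ i → g (suc i) ≡ g i + f i) → g n ≡ g 0 + Σ< n f
  Σ-telescope zero    f g step = sym (ℚ.+-identityʳ (g 0))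
  Σ-telescope (suc n) f g step = trans (step n) (trans (cong (_+ f n) (Σ-telescope n f g step)) (ℚ.+-assoc (g 0) _ _))

  -- Binomial coefficients and Apéry numbers

  binom : ℕ → ℕ → ℚ
  binom n k = ℕ→ℚ (n C k)

  pascal : ∀ n k → binom (suc n) (suc k) ≡ binom n k + binom n (suc k)
  pascal n k = trans (cong ℕ→ℚ (sym (nCk+nC[k+1]≡[n+1]C[k+1] n k))) (ℕ→ℚ-+ (n C k) (n C suc k))

  binom-vanishes : ∀ {n k} → n ℕ.< k → binom n k ≡ 0ℚ
  binom-vanishes n<k = cong ℕ→ℚ (k>n⇒nCk≡0 n<k)

  binom-absorb : ∀ n k → ℕ→ℚ (suc k) * binom (suc n) (suc k) ≡ ℕ→ℚ (suc n) * binom n k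
  binom-absorb zero    zero    = refl
  binom-absorb zero    (suc k) = trans (cong (ℕ→ℚ (suc (suc k)) *_) (binom-vanishes {1} {suc (suc k)} (s≤s (s≤s z≤n))))
    (trans (ℚ.*-zeroʳ (ℕ→ℚ (suc (suc k)))) (sym (cong (1ℚ *_) (binom-vanishes {0} {suc k} (s≤s z≤n)))))
  binom-absorb (suc n) zero    = trans (cong (1ℚ *_) (pascal (suc n) 0))
    (trans (lem (binom (suc n) 1)) (trans (cong (_+_ 1ℚ) (trans (binom-absorb n 0) (ℚ.*-identityʳ (ℕ→ℚ (suc n)))))
    (trans (sym (ℕ→ℚ-suc (suc n))) (sym (ℚ.*-identityʳ (ℕ→ℚ (suc (suc n))))))))
    where
    lem : ∀ x → 1ℚ * (1ℚ + x) ≡ 1ℚ + 1ℚ * x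
    lem = solve-∀ ℚ-ring
  binom-absorb (suc n) (suc k) = begin
    K₂ * binom (suc (suc n)) (suc (suc k))  ≡⟨ cong (K₂ *_) (pascal (suc n) (suc k)) ⟩
    K₂ * (x + y)                            ≡⟨ ℚ.*-distribˡ-+ K₂ x y ⟩
    K₂ * x + K₂ * y                         ≡⟨ cong₂ (λ a b → a * x + b) (ℕ→ℚ-suc (suc k)) (binom-absorb n (suc k)) ⟩
    (1ℚ + ℕ→ℚ (suc k)) * x + N₁ * z         ≡⟨ lem₁ (ℕ→ℚ (suc k)) x (N₁ * z) ⟩
    x + (ℕ→ℚ (suc k) * x + N₁ * z)          ≡⟨ cong (λ a → x + (a + N₁ * z)) (binom-absorb n k) ⟩
    x + (N₁ * binom n k + N₁ * z)           ≡⟨ cong (_+_ x) (sym (ℚ.*-distribˡ-+ N₁ (binom n k) z)) ⟩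
    x + N₁ * (binom n k + z)                ≡⟨ cong (λ a → x + N₁ * a) (sym (pascal n k)) ⟩
    x + N₁ * x                              ≡⟨ lem₂ x N₁ ⟩
    (1ℚ + N₁) * x                           ≡⟨ cong (_* x) (sym (ℕ→ℚ-suc (suc n))) ⟩
    ℕ→ℚ (suc (suc n)) * x                   ∎
    where
    open ≡-Reasoning
    K₂ N₁ x y z : ℚ
    K₂ = ℕ→ℚ (suc (suc k))
    N₁ = ℕ→ℚ (suc n)
    x = binom (suc n) (suc k)
    y = binom (suc n) (suc (suc k))
    z = binom n (suc k)
    lem₁ : ∀ k x r → (1ℚ + k) * x + r ≡ x + (k * x + r)
    lem₁ = solve-∀ ℚ-ring
    lem₂ : ∀ x n → x + n * x ≡ (1ℚ + n) * x
    lem₂ = solve-∀ ℚ-ring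

  binom-next : ∀ n k → ℕ→ℚ (suc k) * binom n (suc k) ≡ (ℕ→ℚ n - ℕ→ℚ k) * binom n k
  binom-next n k = begin
    K * y                                   ≡⟨ lem₁ K (binom n k) y ⟩
    K * (binom n k + y) - K * binom n k     ≡⟨ cong₂ (λ a b → K * a - b * binom n k) (sym (pascal n k)) (ℕ→ℚ-suc k) ⟩
    K * binom (suc n) (suc k) - (1ℚ + ℕ→ℚ k) * binom n k
                                            ≡⟨ cong (_- (1ℚ + ℕ→ℚ k) * binom n k)
                                                (trans (binom-absorb n k) (cong (_* binom n k) (ℕ→ℚ-suc n))) ⟩
    (1ℚ + ℕ→ℚ n) * binom n k - (1ℚ + ℕ→ℚ k) * binom n k ≡⟨ lem₂ (ℕ→ℚ n) (ℕ→ℚ k) (binom n k) ⟩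
    (ℕ→ℚ n - ℕ→ℚ k) * binom n k             ∎
    where
    open ≡-Reasoning
    K y : ℚ
    K = ℕ→ℚ (suc k)
    y = binom n (suc k)
    lem₁ : ∀ k x y → k * y ≡ k * (x + y) - k * x
    lem₁ = solve-∀ ℚ-ring
    lem₂ : ∀ n k x → (1ℚ + n) * x - (1ℚ + k) * x ≡ (n - k) * x
    lem₂ = solve-∀ ℚ-ring

  -- α j k = C(k+j,j) C(k,j), by recursion on j.
  α : ℕ → ℕ → ℚ
  α zero    k = 1ℚ
  α (suc j) k = α j k * ((ℕ→ℚ k + ℕ→ℚ (suc j)) * (ℕ→ℚ k - ℕ→ℚ j)) * v (suc j) ^ 2

  -- Raising j multiplies C(k+j, j) by (k+j+1)/(j+1), by absorption, and C(k, j) by (k-j)/(j+1), by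
  -- `binom-next`.
  binom-product : ∀ j k → binom (k ℕ.+ j) j * binom k j ≡ α j k
  binom-product zero    k = refl
  binom-product (suc j) k = begin
    binom (k ℕ.+ suc j) (suc j) * binom k (suc j)
      ≡⟨ cong (λ n → binom n (suc j) * binom k (suc j)) (ℕ.+-suc k j) ⟩
    x * y
      ≡⟨ cong₂ _*_ (sym (cancel {J} {V} x (v-inverse j))) (sym (cancel {J} {V} y (v-inverse j))) ⟩
    (V * (J * x)) * (V * (J * y))
      ≡⟨ cong₂ (λ a b → (V * a) * (V * b)) (binom-absorb (k ℕ.+ j) j) (binom-next k j) ⟩
    (V * (ℕ→ℚ (suc (k ℕ.+ j)) * x₀)) * (V * ((K - ℕ→ℚ j) * y₀))
      ≡⟨ cong (λ n → (V * (n * x₀)) * (V * ((K - ℕ→ℚ j) * y₀))) (trans (cong ℕ→ℚ (sym (ℕ.+-suc k j))) (ℕ→ℚ-+ k (suc j))) ⟩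
    (V * ((K + J) * x₀)) * (V * ((K - ℕ→ℚ j) * y₀))
      ≡⟨ lem V (K + J) (K - ℕ→ℚ j) x₀ y₀ ⟩
    x₀ * y₀ * ((K + J) * (K - ℕ→ℚ j)) * V ^ 2
      ≡⟨ cong (λ z → z * ((K + J) * (K - ℕ→ℚ j)) * V ^ 2) (binom-product j k) ⟩
    α (suc j) k ∎
    where
    open ≡-Reasoning
    K J V x y x₀ y₀ : ℚ
    K = ℕ→ℚ k
    J = ℕ→ℚ (suc j)
    V = v (suc j)
    x = binom (suc (k ℕ.+ j)) (suc j)
    y = binom k (suc j)
    x₀ = binom (k ℕ.+ j) j
    y₀ = binom k j
    lem : ∀ V s d x y → (V * (s * x)) * (V * (d * y)) ≡ x * y * (s * d) * V ^ 2
    lem = solve-∀ ℚ-ring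

  α-vanishes : ∀ {j k} → k ℕ.< j → α j k ≡ 0ℚ
  α-vanishes {j} {k} k<j = trans (sym (binom-product j k))
    (trans (cong (binom (k ℕ.+ j) j *_) (binom-vanishes k<j)) (ℚ.*-zeroʳ (binom (k ℕ.+ j) j)))

  -- The local function of apery cannot be named from here; unification recovers it.
  aperyPartial : ℕ → ℕ → ℕ
  apery-unfold : ∀ k → apery (suc k) ≡ aperyPartial (suc k) k
    ℕ.+ ((suc k ℕ.+ k) C k) ℕ^ 2 ℕ.* (suc k C k) ℕ^ 2
    ℕ.+ ((suc k ℕ.+ suc k) C suc k) ℕ^ 2 ℕ.* (suc k C suc k) ℕ^ 2
  aperyPartial = _
  -- Once `suc k` is a variable, the unknown function is applied to distinct variables, which
  -- determines it.
  apery-unfold k with suc k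
  ... | _ = refl

  aperyPartial≡Σ : ∀ k n → ℕ→ℚ (aperyPartial k n) ≡ Σ< n (λ j → α j k ^ 2)
  aperyPartial≡Σ k zero    = refl
  aperyPartial≡Σ k (suc n) = trans (ℕ→ℚ-+ (aperyPartial k n) _)
    (cong₂ _+_ (aperyPartial≡Σ k n) (begin
    ℕ→ℚ (x ℕ^ 2 ℕ.* y ℕ^ 2)       ≡⟨ ℕ→ℚ-* (x ℕ^ 2) (y ℕ^ 2) ⟩
    ℕ→ℚ (x ℕ^ 2) * ℕ→ℚ (y ℕ^ 2)  ≡⟨ cong₂ _*_ (ℕ→ℚ-^ x 2) (ℕ→ℚ-^ y 2) ⟩
    ℕ→ℚ x ^ 2 * ℕ→ℚ y ^ 2        ≡⟨ lem (ℕ→ℚ x) (ℕ→ℚ y) ⟩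
    (ℕ→ℚ x * ℕ→ℚ y) ^ 2          ≡⟨ cong (_^ 2) (binom-product n k) ⟩
    α n k ^ 2                     ∎))
    where
    open ≡-Reasoning
    x y : ℕ
    x = (k ℕ.+ n) C n
    y = k C n
    lem : ∀ x y → x ^ 2 * y ^ 2 ≡ (x * y) ^ 2
    lem = solve-∀ ℚ-ring

  Σ-extend : ∀ {m n} → m ℕ.≤ n → ∀ (f : ℕ → ℚ) → (∀ i → m ℕ.≤ i → f i ≡ 0ℚ) → Σ< n f ≡ Σ< m f
  Σ-extend m≤n f = go (ℕ.≤⇒≤′ m≤n)
    where
    go : ∀ {m n} → m ℕ.≤′ n → (∀ i → m ℕ.≤ i → f i ≡ 0ℚ) → Σ< n f ≡ Σ< m f
    go (ℕ.≤′-reflexive refl) vanish = refl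
    go {n = suc n} (ℕ.≤′-step m≤n) vanish = trans (cong₂ _+_ (go m≤n vanish) (vanish n (ℕ.≤′⇒≤ m≤n))) (ℚ.+-identityʳ _)

  -- The terms with j > k vanish, so all k < n can share the range j < n. This makes the double sum
  -- rectangular, so that its order can be exchanged.
  apery≡Σ : ∀ {k n} → k ℕ.< n → ℕ→ℚ (apery k) ≡ Σ< n (λ j → α j k ^ 2)
  apery≡Σ {k} {n} k<n = trans (trans (cong ℕ→ℚ (complete k)) (aperyPartial≡Σ k (suc k)))
    (sym (Σ-extend k<n _ (λ j k<j → cong (_^ 2) (α-vanishes k<j))))
    where
    complete : ∀ k → apery k ≡ aperyPartial k (suc k)
    complete zero    = refl
    complete (suc k) = refl

  -- Since `α j k` is (k+j)! / (j!² (k-j)!), consecutive values have the ratio (k+1+j)/(k+1-j). It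
  -- is cross-multiplied because the denominator vanishes at j = k + 1.
  α-shift : ∀ j k → α j (suc k) * (1ℚ + ℕ→ℚ k - ℕ→ℚ j) ≡ α j k * (1ℚ + ℕ→ℚ k + ℕ→ℚ j)
  α-shift zero    k = refl
  α-shift (suc j) k = begin
    α j (suc k) * ((ℕ→ℚ (suc k) + ℕ→ℚ (suc j)) * (ℕ→ℚ (suc k) - J)) * V * (1ℚ + K - ℕ→ℚ (suc j))
      ≡⟨ cong₂ (λ s t → α j (suc k) * ((s + t) * (s - J)) * V * (1ℚ + K - t)) (ℕ→ℚ-suc k) (ℕ→ℚ-suc j) ⟩
    α j (suc k) * (((1ℚ + K) + (1ℚ + J)) * (1ℚ + K - J)) * V * (1ℚ + K - (1ℚ + J))
      ≡⟨ lem₁ (α j (suc k)) K J V ⟩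
    α j (suc k) * (1ℚ + K - J) * ((1ℚ + K) + (1ℚ + J)) * (K - J) * V
      ≡⟨ cong (λ x → x * ((1ℚ + K) + (1ℚ + J)) * (K - J) * V) (α-shift j k) ⟩
    α j k * (1ℚ + K + J) * ((1ℚ + K) + (1ℚ + J)) * (K - J) * V
      ≡⟨ lem₂ (α j k) K J V ⟩
    α j k * ((K + (1ℚ + J)) * (K - J)) * V * (1ℚ + K + (1ℚ + J))
      ≡⟨ cong (λ t → α j k * ((K + t) * (K - J)) * V * (1ℚ + K + t)) (sym (ℕ→ℚ-suc j)) ⟩
    α (suc j) k * (1ℚ + K + ℕ→ℚ (suc j)) ∎
    where
    open ≡-Reasoning
    K J V : ℚ
    K = ℕ→ℚ k
    J = ℕ→ℚ j
    V = v (suc j) ^ 2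
    lem₁ : ∀ x K J V → x * (((1ℚ + K) + (1ℚ + J)) * (1ℚ + K - J)) * V * (1ℚ + K - (1ℚ + J))
                     ≡ x * (1ℚ + K - J) * ((1ℚ + K) + (1ℚ + J)) * (K - J) * V
    lem₁ = solve-∀ ℚ-ring
    lem₂ : ∀ x K J V → x * (1ℚ + K + J) * ((1ℚ + K) + (1ℚ + J)) * (K - J) * V
                     ≡ x * ((K + (1ℚ + J)) * (K - J)) * V * (1ℚ + K + (1ℚ + J))
    lem₂ = solve-∀ ℚ-ring

  -- Summing (2k+1)³ α j k ² over k < n telescopes to this value.
  G : ℕ → ℕ → ℚ
  G j n = α j n ^ 2 * (ℕ→ℚ n - ℕ→ℚ j) ^ 2 * (ℕ→ℚ 2 * ℕ→ℚ n ^ 2 * v (suc j) - 1ℚ)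

  G-zero : ∀ j → G j 0 ≡ 0ℚ
  G-zero zero    = refl
  G-zero (suc j) = trans (cong (λ x → x ^ 2 * (0ℚ - ℕ→ℚ (suc j)) ^ 2 * c) (α-vanishes {suc j} {0} (s≤s z≤n)))
    (lem ((0ℚ - ℕ→ℚ (suc j)) ^ 2) c)
    where
    c : ℚ
    c = ℕ→ℚ 2 * 0ℚ ^ 2 * v (suc (suc j)) - 1ℚ
    lem : ∀ x y → 0ℚ ^ 2 * x * y ≡ 0ℚ
    lem = solve-∀ ℚ-ring

  G-step : ∀ j k → G j (suc k) ≡ G j k + (ℕ→ℚ 2 * ℕ→ℚ k + 1ℚ) ^ 3 * α j k ^ 2
  G-step j k = begin
    α j (suc k) ^ 2 * (ℕ→ℚ (suc k) - J) ^ 2 * (ℕ→ℚ 2 * ℕ→ℚ (suc k) ^ 2 * V - 1ℚ)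
      ≡⟨ cong (λ t → α j (suc k) ^ 2 * (t - J) ^ 2 * (ℕ→ℚ 2 * t ^ 2 * V - 1ℚ)) (ℕ→ℚ-suc k) ⟩
    α j (suc k) ^ 2 * (1ℚ + K - J) ^ 2 * (ℕ→ℚ 2 * (1ℚ + K) ^ 2 * V - 1ℚ)
      ≡⟨ lem₁ (α j (suc k)) (1ℚ + K - J) (ℕ→ℚ 2 * (1ℚ + K) ^ 2 * V - 1ℚ) ⟩
    (α j (suc k) * (1ℚ + K - J)) ^ 2 * (ℕ→ℚ 2 * (1ℚ + K) ^ 2 * V - 1ℚ)
      ≡⟨ cong (λ t → t ^ 2 * (ℕ→ℚ 2 * (1ℚ + K) ^ 2 * V - 1ℚ)) (α-shift j k) ⟩
    (α j k * (1ℚ + K + J)) ^ 2 * (ℕ→ℚ 2 * (1ℚ + K) ^ 2 * V - 1ℚ)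
      ≡⟨ lem₂ (α j k) K J V ⟩
    G j k + (ℕ→ℚ 2 * K + 1ℚ) ^ 3 * α j k ^ 2 + α j k ^ 2 * R * ((1ℚ + J) * V - 1ℚ)
      ≡⟨ cong (λ t → G j k + (ℕ→ℚ 2 * K + 1ℚ) ^ 3 * α j k ^ 2 + α j k ^ 2 * R * (t - 1ℚ))
              (trans (cong (_* V) (sym (ℕ→ℚ-suc j))) (v-inverse j)) ⟩
    G j k + (ℕ→ℚ 2 * K + 1ℚ) ^ 3 * α j k ^ 2 + α j k ^ 2 * R * (1ℚ - 1ℚ)
      ≡⟨ lem₃ (G j k + (ℕ→ℚ 2 * K + 1ℚ) ^ 3 * α j k ^ 2) (α j k ^ 2 * R) ⟩
    G j k + (ℕ→ℚ 2 * K + 1ℚ) ^ 3 * α j k ^ 2 ∎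
    where
    open ≡-Reasoning
    K J V R : ℚ
    K = ℕ→ℚ k
    J = ℕ→ℚ j
    V = v (suc j)
    -- For the ring solver `V` is independent of `J`, so the two sides differ by a multiple of (1 +
    -- J)V - 1, which is zero for V = 1/(j+1). The cofactor of that difference is `α j k ^ 2 * R`.
    R = ℕ→ℚ 2 * (ℕ→ℚ 2 * K + 1ℚ) * (ℕ→ℚ 2 * K * (1ℚ + K) + 1ℚ + J)
    lem₁ : ∀ x y c → x ^ 2 * y ^ 2 * c ≡ (x * y) ^ 2 * c
    lem₁ = solve-∀ ℚ-ring
    lem₂ : ∀ x K J V → (x * (1ℚ + K + J)) ^ 2 * (ℕ→ℚ 2 * (1ℚ + K) ^ 2 * V - 1ℚ)
      ≡ x ^ 2 * (K - J) ^ 2 * (ℕ→ℚ 2 * K ^ 2 * V - 1ℚ) + (ℕ→ℚ 2 * K + 1ℚ) ^ 3 * x ^ 2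
        + x ^ 2 * (ℕ→ℚ 2 * (ℕ→ℚ 2 * K + 1ℚ) * (ℕ→ℚ 2 * K * (1ℚ + K) + 1ℚ + J)) * ((1ℚ + J) * V - 1ℚ)
    lem₂ = solve-∀ ℚ-ring
    lem₃ : ∀ x y → x + y * (1ℚ - 1ℚ) ≡ x
    lem₃ = solve-∀ ℚ-ring

  -- At N = n this equals C(n-1,j) C(n+j,j).
  w : ℚ → ℕ → ℚ
  w N zero    = 1ℚ
  w N (suc j) = w N j * (N ^ 2 * v (suc j) ^ 2 - 1ℚ)

  -- The new factor n - (j+1) on the left pairs with the n + (j+1) inside `α (suc j) n` to give n² -
  -- (j+1)², leaving n - j for the induction hypothesis. Hence everything but the leading n is even
  -- in n.
  α-w : ∀ j n → α j n * (ℕ→ℚ n - ℕ→ℚ j) ≡ ℕ→ℚ n * w (ℕ→ℚ n) j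
  α-w zero    n = lem (ℕ→ℚ n)
    where
    lem : ∀ x → 1ℚ * (x - 0ℚ) ≡ x * 1ℚ
    lem = solve-∀ ℚ-ring
  α-w (suc j) n = begin
    α j n * ((N + J) * (N - ℕ→ℚ j)) * V ^ 2 * (N - J)          ≡⟨ lem₁ (α j n) N J (ℕ→ℚ j) V ⟩
    α j n * (N - ℕ→ℚ j) * (N ^ 2 * V ^ 2 - (J * V) ^ 2)        ≡⟨ cong₂ (λ x y → x * (N ^ 2 * V ^ 2 - y ^ 2))
        (α-w j n) (v-inverse j) ⟩
    N * w N j * (N ^ 2 * V ^ 2 - 1ℚ ^ 2)                       ≡⟨ lem₂ N (w N j) (N ^ 2 * V ^ 2) ⟩
    N * w N (suc j)                                            ∎
    where
    open ≡-Reasoning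
    N J V : ℚ
    N = ℕ→ℚ n
    J = ℕ→ℚ (suc j)
    V = v (suc j)
    lem₁ : ∀ x N J J₀ V → x * ((N + J) * (N - J₀)) * V ^ 2 * (N - J) ≡ x * (N - J₀) * (N ^ 2 * V ^ 2 - (J * V) ^ 2)
    lem₁ = solve-∀ ℚ-ring
    lem₂ : ∀ x y z → x * y * (z - 1ℚ ^ 2) ≡ x * (y * (z - 1ℚ))
    lem₂ = solve-∀ ℚ-ring

  G-w : ∀ j n → G j n ≡ ℕ→ℚ n ^ 2 * (w (ℕ→ℚ n) j ^ 2 * (ℕ→ℚ 2 * ℕ→ℚ n ^ 2 * v (suc j) - 1ℚ))
  G-w j n = trans (lem₁ (α j n) (ℕ→ℚ n - ℕ→ℚ j) c) (trans (cong (λ x → x ^ 2 * c) (α-w j n)) (lem₂ (ℕ→ℚ n) (w (ℕ→ℚ n) j) c))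
    where
    c : ℚ
    c = ℕ→ℚ 2 * ℕ→ℚ n ^ 2 * v (suc j) - 1ℚ
    lem₁ : ∀ x y c → x ^ 2 * y ^ 2 * c ≡ (x * y) ^ 2 * c
    lem₁ = solve-∀ ℚ-ring
    lem₂ : ∀ x y c → (x * y) ^ 2 * c ≡ x ^ 2 * (y ^ 2 * c)
    lem₂ = solve-∀ ℚ-ring

  -- Summation by parts: -j w_j² is a discrete antiderivative up to the term N⁴ w_j²/(j+1)³.
  w-telescope : ∀ N j → - (ℕ→ℚ (suc j) * w N (suc j) ^ 2) ≡
    - (ℕ→ℚ j * w N j ^ 2) + (w N j ^ 2 * (ℕ→ℚ 2 * N ^ 2 * v (suc j) - 1ℚ) - N ^ 4 * (w N j ^ 2 * v (suc j) ^ 3))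
  w-telescope N j = begin
    - (ℕ→ℚ (suc j) * (W * (N ^ 2 * V ^ 2 - 1ℚ)) ^ 2)
      ≡⟨ cong (λ t → - (t * (W * (N ^ 2 * V ^ 2 - 1ℚ)) ^ 2)) (ℕ→ℚ-suc j) ⟩
    - ((1ℚ + J) * (W * (N ^ 2 * V ^ 2 - 1ℚ)) ^ 2)
      ≡⟨ lem₁ N J V W ⟩
    F + W ^ 2 * (N ^ 2 * V * ℕ→ℚ 2 - N ^ 4 * V ^ 3) * ((1ℚ + J) * V - 1ℚ)
      ≡⟨ cong (λ t → F + W ^ 2 * (N ^ 2 * V * ℕ→ℚ 2 - N ^ 4 * V ^ 3) * (t - 1ℚ))
          (trans (cong (_* V) (sym (ℕ→ℚ-suc j))) (v-inverse j)) ⟩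
    F + W ^ 2 * (N ^ 2 * V * ℕ→ℚ 2 - N ^ 4 * V ^ 3) * (1ℚ - 1ℚ)
      ≡⟨ lem₂ F (W ^ 2 * (N ^ 2 * V * ℕ→ℚ 2 - N ^ 4 * V ^ 3)) ⟩
    F ∎
    where
    open ≡-Reasoning
    J V W F : ℚ
    J = ℕ→ℚ j
    V = v (suc j)
    W = w N j
    F = - (J * W ^ 2) + (W ^ 2 * (ℕ→ℚ 2 * N ^ 2 * V - 1ℚ) - N ^ 4 * (W ^ 2 * V ^ 3))
    lem₁ : ∀ N J V W → - ((1ℚ + J) * (W * (N ^ 2 * V ^ 2 - 1ℚ)) ^ 2)
      ≡ - (J * W ^ 2) + (W ^ 2 * (ℕ→ℚ 2 * N ^ 2 * V - 1ℚ) - N ^ 4 * (W ^ 2 * V ^ 3))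
        + W ^ 2 * (N ^ 2 * V * ℕ→ℚ 2 - N ^ 4 * V ^ 3) * ((1ℚ + J) * V - 1ℚ)
    lem₁ = solve-∀ ℚ-ring
    lem₂ : ∀ x y → x + y * (1ℚ - 1ℚ) ≡ x
    lem₂ = solve-∀ ℚ-ring

  -- The factor with i = n of the product is n²/n² - 1.
  w-end : ∀ n → w (ℕ→ℚ (suc n)) (suc n) ≡ 0ℚ
  w-end n = trans (lem (w N n) N (v (suc n))) (trans (cong (λ t → w N n * (t ^ 2 - 1ℚ)) (v-inverse n)) (ℚ.*-zeroʳ (w N n)))
    where
    N : ℚ
    N = ℕ→ℚ (suc n)
    lem : ∀ w N V → w * (N ^ 2 * V ^ 2 - 1ℚ) ≡ w * ((N * V) ^ 2 - 1ℚ)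
    lem = solve-∀ ℚ-ring

  apery-sum : ∀ m → let N = ℕ→ℚ (suc m) in
    Σ< (suc m) (λ k → ℕ→ℚ ((2 ℕ.* k ℕ.+ 1) ℕ^ 3 ℕ.* apery k)) ≡ N ^ 6 * Σ< (suc m) (λ j → w N j ^ 2 * v (suc j) ^ 3)
  apery-sum m = begin
    Σ< n (λ k → ℕ→ℚ ((2 ℕ.* k ℕ.+ 1) ℕ^ 3 ℕ.* apery k))
      ≡⟨ Σ-cong n summand ⟩
    Σ< n (λ k → Σ< n (λ j → (ℕ→ℚ 2 * ℕ→ℚ k + 1ℚ) ^ 3 * α j k ^ 2))
      ≡⟨ Σ-swap n n _ ⟩
    Σ< n (λ j → Σ< n (λ k → (ℕ→ℚ 2 * ℕ→ℚ k + 1ℚ) ^ 3 * α j k ^ 2))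
      ≡⟨ Σ-ext n inner ⟩
    Σ< n (λ j → N ^ 2 * (w N j ^ 2 * (ℕ→ℚ 2 * N ^ 2 * v (suc j) - 1ℚ)))
      ≡⟨ Σ-*ˡ n (N ^ 2) _ ⟩
    N ^ 2 * Σ< n g
      ≡⟨ cong (N ^ 2 *_) byParts ⟩
    N ^ 2 * (N ^ 4 * X)
      ≡⟨ lem₁ N X ⟩
    N ^ 6 * X ∎
    where
    open ≡-Reasoning
    n : ℕ
    n = suc m
    N X : ℚ
    N = ℕ→ℚ n
    f g : ℕ → ℚ
    f j = w N j ^ 2 * v (suc j) ^ 3
    g j = w N j ^ 2 * (ℕ→ℚ 2 * N ^ 2 * v (suc j) - 1ℚ)
    X = Σ< n f
    lem₁ : ∀ N X → N ^ 2 * (N ^ 4 * X) ≡ N ^ 6 * X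
    lem₁ = solve-∀ ℚ-ring

    summand : ∀ k → k ℕ.< n → ℕ→ℚ ((2 ℕ.* k ℕ.+ 1) ℕ^ 3 ℕ.* apery k) ≡ Σ< n (λ j → (ℕ→ℚ 2 * ℕ→ℚ k + 1ℚ) ^ 3 * α j k ^ 2)
    summand k k<n = begin
      ℕ→ℚ ((2 ℕ.* k ℕ.+ 1) ℕ^ 3 ℕ.* apery k)
        ≡⟨ ℕ→ℚ-* ((2 ℕ.* k ℕ.+ 1) ℕ^ 3) (apery k) ⟩
      ℕ→ℚ ((2 ℕ.* k ℕ.+ 1) ℕ^ 3) * ℕ→ℚ (apery k)
        ≡⟨ cong₂ _*_ (ℕ→ℚ-^ (2 ℕ.* k ℕ.+ 1) 3) (apery≡Σ k<n) ⟩
      ℕ→ℚ (2 ℕ.* k ℕ.+ 1) ^ 3 * Σ< n (λ j → α j k ^ 2)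
        ≡⟨ cong (λ t → t ^ 3 * Σ< n (λ j → α j k ^ 2)) (trans (ℕ→ℚ-+ (2 ℕ.* k) 1) (cong (_+ 1ℚ) (ℕ→ℚ-* 2 k))) ⟩
      (ℕ→ℚ 2 * ℕ→ℚ k + 1ℚ) ^ 3 * Σ< n (λ j → α j k ^ 2)
        ≡⟨ sym (Σ-*ˡ n ((ℕ→ℚ 2 * ℕ→ℚ k + 1ℚ) ^ 3) (λ j → α j k ^ 2)) ⟩
      Σ< n (λ j → (ℕ→ℚ 2 * ℕ→ℚ k + 1ℚ) ^ 3 * α j k ^ 2) ∎

    inner : ∀ j → Σ< n (λ k → (ℕ→ℚ 2 * ℕ→ℚ k + 1ℚ) ^ 3 * α j k ^ 2) ≡ N ^ 2 * (w N j ^ 2 * (ℕ→ℚ 2 * N ^ 2 * v (suc j) - 1ℚ))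
    inner j = trans (sym (trans (Σ-telescope n f₀ (G j) (G-step j))
        (trans (cong (_+ Σ< n f₀) (G-zero j)) (ℚ.+-identityˡ (Σ< n f₀))))) (G-w j n)
      where
      f₀ : ℕ → ℚ
      f₀ k = (ℕ→ℚ 2 * ℕ→ℚ k + 1ℚ) ^ 3 * α j k ^ 2

    byParts : Σ< n g ≡ N ^ 4 * X
    byParts = begin
      Σ< n g
        ≡⟨ Σ-ext n (λ j → lem (g j) (N ^ 4 * f j)) ⟩
      Σ< n (λ j → N ^ 4 * f j + (g j - N ^ 4 * f j))
        ≡⟨ Σ-+ n _ _ ⟩
      Σ< n (λ j → N ^ 4 * f j) + Σ< n (λ j → g j - N ^ 4 * f j)
        ≡⟨ cong₂ _+_ (Σ-*ˡ n (N ^ 4) f) antiderivative ⟩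
      N ^ 4 * X + 0ℚ
        ≡⟨ ℚ.+-identityʳ _ ⟩
      N ^ 4 * X ∎
      where
      lem : ∀ x y → x ≡ y + (x - y)
      lem = solve-∀ ℚ-ring
      lem₀ : ∀ c → - (c * 0ℚ ^ 2) ≡ 0ℚ
      lem₀ = solve-∀ ℚ-ring
      -- Both boundary values of -j w_j² vanish: at j = 0 by the factor j, at j = n by `w-end`.
      antiderivative : Σ< n (λ j → g j - N ^ 4 * f j) ≡ 0ℚ
      antiderivative = trans (sym (ℚ.+-identityˡ _))
        (trans (sym (Σ-telescope n _ (λ j → - (ℕ→ℚ j * w N j ^ 2)) (w-telescope N)))
        (trans (cong (λ t → - (N * t ^ 2)) (w-end m)) (lem₀ N)))

  -- Divisibility by powers of p in ℤ₍ₚ₎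

  ^-+ : ∀ x m n → x ^ (m ℕ.+ n) ≡ x ^ m * x ^ n
  ^-+ x zero    n = sym (ℚ.*-identityˡ _)
  ^-+ x (suc m) n = trans (^-suc x (m ℕ.+ n)) (trans (cong (x *_) (^-+ x m n))
    (trans (sym (ℚ.*-assoc x (x ^ m) (x ^ n))) (cong (_* x ^ n) (sym (^-suc x m)))))

  module PIntegral (p : ℕ) (p-prime : Prime p) where

    P : ℚ
    P = ℕ→ℚ p

    -- Membership in ℤ₍ₚ₎ through any clearing multiplier prime to p, not the reduced denominator:
    -- closure under sums and products then needs no cancellation, and lowest terms are considered
    -- only once, in `Integral⇒coprime`.
    record Integral (r : ℚ) : Set where
      constructor integral
      field
        multiplier  : ℕ
        unit        : ¬ (p ∣ multiplier)
        value       : ℤ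
        clears      : ℕ→ℚ multiplier * r ≡ int value

    p∤* : ∀ {d e} → ¬ (p ∣ d) → ¬ (p ∣ e) → ¬ (p ∣ d ℕ.* e)
    p∤* {d} {e} p∤d p∤e p∣de with euclidsLemma d e p-prime p∣de
    ... | inj₁ p∣d = p∤d p∣d
    ... | inj₂ p∣e = p∤e p∣e

    p∤<p : ∀ {d} → .{{ℕ.NonZero d}} → d ℕ.< p → ¬ (p ∣ d)
    p∤<p d<p p∣d = ℕ.<⇒≱ d<p (∣⇒≤ p∣d)

    Integral-int : ∀ z → Integral (int z)
    Integral-int z = integral 1 (p∤<p (ℕ.nonTrivial⇒n>1 p {{prime⇒nonTrivial p-prime}})) z (ℚ.*-identityˡ (int z))

    Integral-ℕ : ∀ n → Integral (ℕ→ℚ n)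
    Integral-ℕ n = Integral-int (+ n)

    Integral-+ : ∀ {x y} → Integral x → Integral y → Integral (x + y)
    Integral-+ {x} {y} (integral d p∤d a dx) (integral e p∤e b ey) =
      integral (d ℕ.* e) (p∤* p∤d p∤e) (+ e ℤ.* a ℤ.+ + d ℤ.* b) (begin
        ℕ→ℚ (d ℕ.* e) * (x + y)                   ≡⟨ cong (_* (x + y)) (ℕ→ℚ-* d e) ⟩
        D * E * (x + y)                           ≡⟨ lem D E x y ⟩
        E * (D * x) + D * (E * y)                 ≡⟨ cong₂ (λ s t → E * s + D * t) dx ey ⟩
        E * int a + D * int b                     ≡⟨ sym (cong₂ _+_ (int-* (+ e) a) (int-* (+ d) b)) ⟩
        int (+ e ℤ.* a) + int (+ d ℤ.* b)         ≡⟨ sym (int-+ (+ e ℤ.* a) (+ d ℤ.* b)) ⟩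
        int (+ e ℤ.* a ℤ.+ + d ℤ.* b)             ∎)
      where
      open ≡-Reasoning
      D E : ℚ
      D = ℕ→ℚ d
      E = ℕ→ℚ e
      lem : ∀ D E x y → D * E * (x + y) ≡ E * (D * x) + D * (E * y)
      lem = solve-∀ ℚ-ring

    Integral-* : ∀ {x y} → Integral x → Integral y → Integral (x * y)
    Integral-* {x} {y} (integral d p∤d a dx) (integral e p∤e b ey) =
      integral (d ℕ.* e) (p∤* p∤d p∤e) (a ℤ.* b) (begin
        ℕ→ℚ (d ℕ.* e) * (x * y)       ≡⟨ cong (_* (x * y)) (ℕ→ℚ-* d e) ⟩
        D * E * (x * y)               ≡⟨ lem D E x y ⟩
        (D * x) * (E * y)             ≡⟨ cong₂ _*_ dx ey ⟩
        int a * int b                 ≡⟨ sym (int-* a b) ⟩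
        int (a ℤ.* b)                 ∎)
      where
      open ≡-Reasoning
      D E : ℚ
      D = ℕ→ℚ d
      E = ℕ→ℚ e
      lem : ∀ D E x y → D * E * (x * y) ≡ (D * x) * (E * y)
      lem = solve-∀ ℚ-ring

    Integral-neg : ∀ {x} → Integral x → Integral (- x)
    Integral-neg {x} (integral d p∤d a dx) = integral d p∤d (ℤ.- a)
      (trans (sym (ℚ.neg-distribʳ-* (ℕ→ℚ d) x)) (trans (cong -_ dx) (sym (int-neg a))))

    Integral-- : ∀ {x y} → Integral x → Integral y → Integral (x - y)
    Integral-- x y = Integral-+ x (Integral-neg y)

    Integral-^ : ∀ {x} n → Integral x → Integral (x ^ n)
    Integral-^ zero    x = Integral-ℕ 1
    Integral-^ {r} (suc n) x = subst Integral (sym (^-suc r n)) (Integral-* x (Integral-^ n x))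

    Integral-v : ∀ {j} → suc j ℕ.< p → Integral (v (suc j))
    Integral-v {j} j<p = integral (suc j) (p∤<p j<p) (+ 1) (v-inverse j)

    Integral-Σ : ∀ n {f} → (∀ i → i ℕ.< n → Integral (f i)) → Integral (Σ< n f)
    Integral-Σ zero    fs = Integral-ℕ 0
    Integral-Σ (suc n) fs = Integral-+ (Integral-Σ n λ i i<n → fs i (ℕ.m<n⇒m<1+n i<n)) (fs n (ℕ.n<1+n n))

    -- In lowest terms the denominator is prime to the numerator, so it divides every integer that
    -- clears the fraction. If p divided it, p would divide the multiplier.
    Integral⇒coprime : ∀ {r} → Integral r → Coprime (↧ₙ r) p
    Integral⇒coprime {r} (integral d p∤d z dr) {e} (e∣b , e∣p) with prime⇒irreducible p-prime e∣p
    ... | inj₁ e≡1 = e≡1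
    ... | inj₂ refl = contradiction (∣-trans e∣b b∣d) p∤d
      where
      open ≡-Reasoning
      lem : ∀ x y r → x * (y * r) ≡ y * (x * r)
      lem = solve-∀ ℚ-ring
      cross : + d ℤ.* ↥ r ≡ ↧ r ℤ.* z
      cross = int-injective (begin
        int (+ d ℤ.* ↥ r)            ≡⟨ int-* (+ d) (↥ r) ⟩
        ℕ→ℚ d * int (↥ r)            ≡⟨ cong (ℕ→ℚ d *_) (sym (denominator-clears r)) ⟩
        ℕ→ℚ d * (int (↧ r) * r)      ≡⟨ lem (ℕ→ℚ d) (int (↧ r)) r ⟩
        int (↧ r) * (ℕ→ℚ d * r)      ≡⟨ cong (int (↧ r) *_) dr ⟩
        int (↧ r) * int z            ≡⟨ sym (int-* (↧ r) z) ⟩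
        int (↧ r ℤ.* z)              ∎)
      lowest : ∀ r → Coprime ℤ.∣ ↥ r ∣ (↧ₙ r)
      lowest (mkℚ _ _ c) = Coprimality.recompute c
      b∣d : ↧ₙ r ∣ d
      b∣d = coprime-divisor (Coprimality.sym (lowest r)) (divides ℤ.∣ z ∣ (begin
        ℤ.∣ ↥ r ∣ ℕ.* d           ≡⟨ ℕ.*-comm ℤ.∣ ↥ r ∣ d ⟩
        d ℕ.* ℤ.∣ ↥ r ∣           ≡⟨ sym (ℤ.abs-* (+ d) (↥ r)) ⟩
        ℤ.∣ + d ℤ.* ↥ r ∣         ≡⟨ cong ℤ.∣_∣ cross ⟩
        ℤ.∣ ↧ r ℤ.* z ∣           ≡⟨ ℤ.abs-* (↧ r) z ⟩
        ↧ₙ r ℕ.* ℤ.∣ z ∣          ≡⟨ ℕ.*-comm (↧ₙ r) ℤ.∣ z ∣ ⟩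
        ℤ.∣ z ∣ ℕ.* ↧ₙ r          ∎))

    -- Div n x: x lies in pⁿℤ₍ₚ₎.
    record Div (n : ℕ) (x : ℚ) : Set where
      constructor div
      field
        quotient    : ℚ
        isIntegral  : Integral quotient
        factors     : x ≡ P ^ n * quotient

    Div-resp : ∀ {n x y} → x ≡ y → Div n x → Div n y
    Div-resp refl d = d

    Div-P^ : ∀ {y} n → Integral y → Div n (P ^ n * y)
    Div-P^ n y = div _ y refl

    Div-0 : ∀ {n} → Div n 0ℚ
    Div-0 {n} = div 0ℚ (Integral-ℕ 0) (sym (ℚ.*-zeroʳ (P ^ n)))

    Div-+ : ∀ {n x y} → Div n x → Div n y → Div n (x + y)
    Div-+ {n} (div q iq eq) (div r ir er) = div (q + r) (Integral-+ iq ir)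
      (trans (cong₂ _+_ eq er) (sym (ℚ.*-distribˡ-+ (P ^ n) q r)))

    Div-scale : ∀ {n x c} → Integral c → Div n x → Div n (c * x)
    Div-scale {n} {c = c} ic (div q iq eq) = div (c * q) (Integral-* ic iq) (trans (cong (c *_) eq) (lem c (P ^ n) q))
      where
      lem : ∀ c x q → c * (x * q) ≡ x * (c * q)
      lem = solve-∀ ℚ-ring

    Div-neg : ∀ {n x} → Div n x → Div n (- x)
    Div-neg {n} {x} d = Div-resp (lem x) (Div-scale (Integral-int (ℤ.- + 1)) d)
      where
      lem : ∀ x → (- 1ℚ) * x ≡ - x
      lem = solve-∀ ℚ-ring

    Div-- : ∀ {n x y} → Div n x → Div n y → Div n (x - y)
    Div-- x y = Div-+ x (Div-neg y)

    Div-raise : ∀ m {n x} → Div n x → Div (m ℕ.+ n) (P ^ m * x)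
    Div-raise m {n} (div q iq eq) = div q iq (trans (cong (P ^ m *_) eq)
      (trans (sym (ℚ.*-assoc (P ^ m) (P ^ n) q)) (cong (_* q) (sym (^-+ P m n)))))

    Div-lower : ∀ m {n x} → Div (m ℕ.+ n) x → Div n x
    Div-lower m {n} (div q iq eq) = div (P ^ m * q) (Integral-* (Integral-^ m (Integral-ℕ p)) iq)
      (trans eq (trans (cong (_* q) (^-+ P m n)) (lem (P ^ m) (P ^ n) q)))
      where
      lem : ∀ x y q → x * y * q ≡ y * (x * q)
      lem = solve-∀ ℚ-ring

    Div⇒Integral : ∀ {n x} → Div n x → Integral x
    Div⇒Integral {n} (div q iq eq) = subst Integral (sym eq) (Integral-* (Integral-^ n (Integral-ℕ p)) iq)

    Div-* : ∀ {m n x y} → Div m x → Div n y → Div (m ℕ.+ n) (x * y)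
    Div-* {m} {n} {x} {y} (div q iq eq) dy = Div-resp (trans (sym (lem (P ^ m) q y)) (cong (_* y) (sym eq)))
      (Div-raise m (Div-scale iq dy))
      where
      lem : ∀ x q y → x * q * y ≡ x * (q * y)
      lem = solve-∀ ℚ-ring

    Div-cancel : ∀ {n x} c u → Integral u → c * u ≡ 1ℚ → Div n (c * x) → Div n x
    Div-cancel {x = x} c u iu cu d = Div-resp (cancel {c} {u} x cu) (Div-scale iu d)

    Div-Σ : ∀ {k} n {f} → (∀ i → i ℕ.< n → Div k (f i)) → Div k (Σ< n f)
    Div-Σ zero    fs = Div-0
    Div-Σ (suc n) fs = Div-+ (Div-Σ n λ i i<n → fs i (ℕ.m<n⇒m<1+n i<n)) (fs n (ℕ.n<1+n n))

    Σ-- : ∀ n f g → Σ< n (λ i → f i - g i) ≡ Σ< n f - Σ< n g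
    Σ-- n f g = trans (Σ-+ n f (λ i → - g i)) (cong (_+_ (Σ< n f))
        (trans (Σ-ext n (λ i → neg (g i))) (trans (Σ-*ˡ n (- 1ℚ) g) (sym (neg (Σ< n g))))))
      where
      neg : ∀ x → - x ≡ (- 1ℚ) * x
      neg = solve-∀ ℚ-ring

    Div-Σ-cong : ∀ {k} n {f g} → (∀ i → i ℕ.< n → Div k (f i - g i)) → Div k (Σ< n f - Σ< n g)
    Div-Σ-cong n {f} {g} fs = Div-resp (Σ-- n f g) (Div-Σ n fs)

    Div⇒CongMod : ∀ n {x y} → Div n (x - y) → CongMod p (ℕ→ℚ (p ℕ^ n)) x y
    Div⇒CongMod n (div r ir eq) = r , Integral⇒coprime ir , trans eq (cong (_* r) (sym (ℕ→ℚ-^ p n)))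

  -- Bernoulli numbers and Faulhaber's formula

  binom-diag : ∀ n → binom n n ≡ 1ℚ
  binom-diag n = cong ℕ→ℚ (nCn≡1 n)

  binom-subdiag : ∀ n → binom (suc n) n ≡ ℕ→ℚ (suc n)
  binom-subdiag zero    = refl
  binom-subdiag (suc n) = trans (pascal (suc n) n) (trans (cong₂ _+_ (binom-subdiag n) (binom-diag (suc n)))
    (trans (ℚ.+-comm (ℕ→ℚ (suc n)) 1ℚ) (sym (ℕ→ℚ-suc (suc n)))))

  -- The private function of bernoulliList cannot be named from here; unification recovers it.
  weightedSum : ℕ → ℕ → List ℚ → ℚ
  bernoulliList-suc : ∀ n → bernoulliList (suc n) ≡
    bernoulliList n ++ [ - (weightedSum (suc (suc n)) 0 (bernoulliList n) * v (suc (suc n))) ]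
  weightedSum = _
  bernoulliList-suc n with bernoulliList n | v (suc (suc n))
  ... | _ | _ with suc (suc n) | zero | Data.Rational._*_
  ... | _ | _ | _ = refl

  weightedSum-++ : ∀ m i bs x → weightedSum m i (bs ++ [ x ]) ≡ weightedSum m i bs + binom m (i ℕ.+ length bs) * x
  weightedSum-++ m i []       x = trans (ℚ.+-comm (binom m i * x) 0ℚ)
      (cong (λ k → 0ℚ + binom m k * x) (sym (ℕ.+-identityʳ i)))
  weightedSum-++ m i (b ∷ bs) x = trans (cong (_+_ (binom m i * b)) (weightedSum-++ m (suc i) bs x))
    (trans (sym (ℚ.+-assoc (binom m i * b) (weightedSum m (suc i) bs) (binom m (suc i ℕ.+ length bs) * x)))
    (cong (λ k → binom m i * b + weightedSum m (suc i) bs + binom m k * x) (sym (ℕ.+-suc i (length bs)))))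

  length-bernoulliList : ∀ n → length (bernoulliList n) ≡ suc n
  length-bernoulliList zero    = refl
  length-bernoulliList (suc n) = trans (length-++ (bernoulliList n))
      (trans (ℕ.+-comm (length (bernoulliList n)) 1) (cong suc (length-bernoulliList n)))

  lastOr-++ : ∀ bs x → lastOr (bs ++ [ x ]) ≡ x
  lastOr-++ []           x = refl
  lastOr-++ (y ∷ [])     x = refl
  lastOr-++ (y ∷ z ∷ bs) x = lastOr-++ (z ∷ bs) x

  B-last : ∀ n → B (suc n) ≡ - (weightedSum (suc (suc n)) 0 (bernoulliList n) * v (suc (suc n)))
  B-last n = trans (cong lastOr (bernoulliList-suc n)) (lastOr-++ (bernoulliList n) _)

  weightedSum≡Σ : ∀ m n → weightedSum m 0 (bernoulliList n) ≡ Σ< (suc n) (λ i → binom m i * B i)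
  weightedSum≡Σ m zero    = ℚ.+-comm (binom m 0 * 1ℚ) 0ℚ
  weightedSum≡Σ m (suc n) = begin
    weightedSum m 0 (bernoulliList (suc n))
      ≡⟨ cong (weightedSum m 0) (bernoulliList-suc n) ⟩
    weightedSum m 0 (bernoulliList n ++ [ b ])
      ≡⟨ weightedSum-++ m 0 (bernoulliList n) b ⟩
    weightedSum m 0 (bernoulliList n) + binom m (length (bernoulliList n)) * b
      ≡⟨ cong₂ (λ k x → weightedSum m 0 (bernoulliList n) + binom m k * x) (length-bernoulliList n) (sym (B-last n)) ⟩
    weightedSum m 0 (bernoulliList n) + binom m (suc n) * B (suc n)
      ≡⟨ cong (_+ binom m (suc n) * B (suc n)) (weightedSum≡Σ m n) ⟩
    Σ< (suc (suc n)) (λ i → binom m i * B i) ∎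
    where
    open ≡-Reasoning
    b : ℚ
    b = - (weightedSum (suc (suc n)) 0 (bernoulliList n) * v (suc (suc n)))

  B-suc : ∀ n → B (suc n) ≡ - (Σ< (suc n) (λ i → binom (suc (suc n)) i * B i) * v (suc (suc n)))
  B-suc n = trans (B-last n) (cong (λ x → - (x * v (suc (suc n)))) (weightedSum≡Σ (suc (suc n)) n))

  B-recurrence : ∀ n → Σ< (suc (suc n)) (λ i → binom (suc (suc n)) i * B i) ≡ 0ℚ
  B-recurrence n = begin
    X + binom (suc (suc n)) (suc n) * B (suc n)    ≡⟨ cong₂ (λ x y → X + x * y) (binom-subdiag (suc n)) (B-suc n) ⟩
    X + N * - (X * v (suc (suc n)))                ≡⟨ lem₁ X N (v (suc (suc n))) ⟩
    X - X * (N * v (suc (suc n)))                  ≡⟨ cong (λ t → X - X * t) (v-inverse (suc n)) ⟩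
    X - X * 1ℚ                                     ≡⟨ lem₂ X ⟩
    0ℚ                                             ∎
    where
    open ≡-Reasoning
    X N : ℚ
    X = Σ< (suc n) (λ i → binom (suc (suc n)) i * B i)
    N = ℕ→ℚ (suc (suc n))
    lem₁ : ∀ X N V → X + N * - (X * V) ≡ X - X * (N * V)
    lem₁ = solve-∀ ℚ-ring
    lem₂ : ∀ X → X - X * 1ℚ ≡ 0ℚ
    lem₂ = solve-∀ ℚ-ring

  -- Umbral calculus: shifted x m s is the value at s of (E + x)^m, where E is the shift of sequences,
  -- i.e. "(s + x)^m" with s^k read as s k.
  shifted : ℚ → ℕ → (ℕ → ℚ) → ℚ
  shifted x zero    s = s 0
  shifted x (suc m) s = shifted x m (s ∘ suc) + x * shifted x m s

  shifted-ext : ∀ x m {s t} → (∀ k → s k ≡ t k) → shifted x m s ≡ shifted x m t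
  shifted-ext x zero    eq = eq 0
  shifted-ext x (suc m) eq = cong₂ (λ a b → a + x * b) (shifted-ext x m (eq ∘ suc)) (shifted-ext x m eq)

  shifted-linear : ∀ x m c s t → shifted x m (λ k → s k + c * t k) ≡ shifted x m s + c * shifted x m t
  shifted-linear x zero    c s t = refl
  shifted-linear x (suc m) c s t = trans (cong₂ (λ a b → a + x * b) (shifted-linear x m c (s ∘ suc) (t ∘ suc))
      (shifted-linear x m c s t))
    (lem c x (shifted x m (s ∘ suc)) (shifted x m (t ∘ suc)) (shifted x m s) (shifted x m t))
    where
    lem : ∀ c x a b d e → a + c * b + x * (d + c * e) ≡ a + x * d + c * (b + x * e)
    lem = solve-∀ ℚ-ring

  -- This is E + (x + y) = (E + y) + x: on the sequence of values of (E + y)^l, shifting the index l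
  -- amounts to applying E + y once more.
  shifted-shifted : ∀ x y m s → shifted (x + y) m s ≡ shifted x m (λ l → shifted y l s)
  shifted-shifted x y zero    s = refl
  shifted-shifted x y (suc m) s = begin
    shifted (x + y) m (s ∘ suc) + (x + y) * shifted (x + y) m s
      ≡⟨ cong₂ (λ a b → a + (x + y) * b) (shifted-shifted x y m (s ∘ suc)) (shifted-shifted x y m s) ⟩
    shifted x m (λ l → shifted y l (s ∘ suc)) + (x + y) * c
      ≡⟨ lem x y (shifted x m (λ l → shifted y l (s ∘ suc))) c ⟩
    shifted x m (λ l → shifted y l (s ∘ suc)) + y * c + x * c
      ≡⟨ cong (_+ x * c) (sym (shifted-linear x m y (λ l → shifted y l (s ∘ suc)) (λ l → shifted y l s))) ⟩
    shifted x m (λ l → shifted y (suc l) s) + x * c ∎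
    where
    open ≡-Reasoning
    c : ℚ
    c = shifted x m (λ l → shifted y l s)
    lem : ∀ x y a c → a + (x + y) * c ≡ a + y * c + x * c
    lem = solve-∀ ℚ-ring

  shifted≡Σ : ∀ x m s → shifted x m s ≡ Σ< (suc m) (λ k → binom m k * s k * x ^ (m ∸ k))
  shifted≡Σ x zero    s = lem (s 0)
    where
    lem : ∀ x → x ≡ 0ℚ + 1ℚ * x * 1ℚ
    lem = solve-∀ ℚ-ring
  shifted≡Σ x (suc m) s = begin
    shifted x m (s ∘ suc) + x * shifted x m s
      ≡⟨ cong₂ (λ a b → a + x * b) (shifted≡Σ x m (s ∘ suc)) (trans (shifted≡Σ x m s) (Σ-head m f)) ⟩
    Σ< (suc m) g + x * (f 0 + Σ< m (f ∘ suc))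
      ≡⟨ cong (λ a → Σ< (suc m) g + a) (trans (ℚ.*-distribˡ-+ x (f 0) (Σ< m (f ∘ suc))) (cong₂ _+_ first rest)) ⟩
    Σ< (suc m) g + (t 0 + Σ< (suc m) h)
      ≡⟨ lem (Σ< (suc m) g) (t 0) (Σ< (suc m) h) ⟩
    t 0 + (Σ< (suc m) g + Σ< (suc m) h)
      ≡⟨ cong (_+_ (t 0)) (trans (sym (Σ-+ (suc m) g h)) (Σ-ext (suc m) combine)) ⟩
    t 0 + Σ< (suc m) (t ∘ suc)
      ≡⟨ sym (Σ-head (suc m) t) ⟩
    Σ< (suc (suc m)) t ∎
    where
    open ≡-Reasoning
    f g h t : ℕ → ℚ
    f k = binom m k * s k * x ^ (m ∸ k)
    g k = binom m k * s (suc k) * x ^ (m ∸ k)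
    h k = binom m (suc k) * s (suc k) * x ^ (m ∸ k)
    t k = binom (suc m) k * s k * x ^ (suc m ∸ k)
    lem : ∀ a b c → a + (b + c) ≡ b + (a + c)
    lem = solve-∀ ℚ-ring
    mulx : ∀ b c y z → z ≡ x * y → x * (b * c * y) ≡ b * c * z
    mulx b c y z refl = lem′ x b c y
      where
      lem′ : ∀ x b c y → x * (b * c * y) ≡ b * c * (x * y)
      lem′ = solve-∀ ℚ-ring
    first : x * f 0 ≡ t 0
    first = mulx (binom m 0) (s 0) (x ^ m) (x ^ suc m) (^-suc x m)
    combine : ∀ k → g k + h k ≡ t (suc k)
    combine k = trans (lem′ (binom m k) (binom m (suc k)) (s (suc k)) (x ^ (m ∸ k)))
      (cong (λ b → b * s (suc k) * x ^ (m ∸ k)) (sym (pascal m k)))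
      where
      lem′ : ∀ b b′ c y → b * c * y + b′ * c * y ≡ (b + b′) * c * y
      lem′ = solve-∀ ℚ-ring
    step : ∀ k → k ℕ.< m → x * f (suc k) ≡ h k
    step k k<m = mulx (binom m (suc k)) (s (suc k)) (x ^ (m ∸ suc k)) (x ^ (m ∸ k))
      (trans (cong (x ^_) (ℕ.+-∸-assoc 1 k<m)) (^-suc x (m ∸ suc k)))
    -- The sums on the two sides have m and m + 1 terms; the additional one carries C(m, m+1) = 0.
    last-vanishes : h m ≡ 0ℚ
    last-vanishes = trans (cong (λ b → b * s (suc m) * x ^ (m ∸ m)) (binom-vanishes (ℕ.n<1+n m)))
        (lem′ (s (suc m)) (x ^ (m ∸ m)))
      where
      lem′ : ∀ a b → 0ℚ * a * b ≡ 0ℚ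
      lem′ = solve-∀ ℚ-ring
    rest : x * Σ< m (f ∘ suc) ≡ Σ< (suc m) h
    rest = begin
      x * Σ< m (f ∘ suc)             ≡⟨ sym (Σ-*ˡ m x (f ∘ suc)) ⟩
      Σ< m (λ k → x * f (suc k))     ≡⟨ Σ-cong m step ⟩
      Σ< m h                         ≡⟨ sym (ℚ.+-identityʳ (Σ< m h)) ⟩
      Σ< m h + 0ℚ                    ≡⟨ cong (_+_ (Σ< m h)) (sym last-vanishes) ⟩
      Σ< (suc m) h                   ∎

  1^n≡1 : ∀ n → 1ℚ ^ n ≡ 1ℚ
  1^n≡1 zero    = refl
  1^n≡1 (suc n) = trans (^-suc 1ℚ n) (trans (ℚ.*-identityˡ (1ℚ ^ n)) (1^n≡1 n))

  δ₁ : ℕ → ℚ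
  δ₁ 1 = 1ℚ
  δ₁ _ = 0ℚ

  -- Symbolically (B + 1)^l = B^l. For l ≥ 2 this is the defining recurrence; at l = 1 the choice B₁
  -- = -1/2 leaves an excess of 1, which `δ₁` records. The factor `1ℚ` fits the shape of
  -- `shifted-linear`.
  shifted-B : ∀ l → shifted 1ℚ l B ≡ B l + 1ℚ * δ₁ l
  shifted-B 0 = refl
  shifted-B 1 = refl
  shifted-B (suc (suc n)) = begin
    shifted 1ℚ l B
      ≡⟨ shifted≡Σ 1ℚ l B ⟩
    Σ< l (λ k → binom l k * B k * 1ℚ ^ (l ∸ k)) + binom l l * B l * 1ℚ ^ (l ∸ l)
      ≡⟨ cong₂ _+_ (Σ-ext l (λ k → unit k)) (trans (unit l) (cong (_* B l) (binom-diag l))) ⟩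
    Σ< l (λ k → binom l k * B k) + 1ℚ * B l
      ≡⟨ cong (_+ 1ℚ * B l) (B-recurrence n) ⟩
    0ℚ + 1ℚ * B l
      ≡⟨ lem (B l) ⟩
    B l + 1ℚ * 0ℚ ∎
    where
    open ≡-Reasoning
    l : ℕ
    l = suc (suc n)
    unit : ∀ k → binom l k * B k * 1ℚ ^ (l ∸ k) ≡ binom l k * B k
    unit k = trans (cong (binom l k * B k *_) (1^n≡1 (l ∸ k))) (ℚ.*-identityʳ (binom l k * B k))
    lem : ∀ b → 0ℚ + 1ℚ * b ≡ b + 1ℚ * 0ℚ
    lem = solve-∀ ℚ-ring

  -- Pairing with `δ₁` extracts the coefficient of E in (E + x)^(m+1), that is, the derivative of
  -- x^(m+1).
  shifted-δ₁ : ∀ x m → shifted x (suc m) δ₁ ≡ ℕ→ℚ (suc m) * x ^ m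
  shifted-δ₁ x zero = lem x
    where
    lem : ∀ x → 1ℚ + x * 0ℚ ≡ 1ℚ * 1ℚ
    lem = solve-∀ ℚ-ring
  shifted-δ₁ x (suc m) = begin
    shifted x (suc m) (δ₁ ∘ suc) + x * shifted x (suc m) δ₁ ≡⟨ cong₂ (λ a b → a + x * b) (power (suc m)) (shifted-δ₁ x m) ⟩
    x ^ suc m + x * (ℕ→ℚ (suc m) * x ^ m)                   ≡⟨ lem x (ℕ→ℚ (suc m)) (x ^ m) (x ^ suc m) ⟩
    x ^ suc m + ℕ→ℚ (suc m) * (x * x ^ m)                   ≡⟨ cong (λ t → x ^ suc m + ℕ→ℚ (suc m) * t) (sym (^-suc x m)) ⟩
    x ^ suc m + ℕ→ℚ (suc m) * x ^ suc m                     ≡⟨ lem′ (ℕ→ℚ (suc m)) (x ^ suc m) ⟩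
    (1ℚ + ℕ→ℚ (suc m)) * x ^ suc m                          ≡⟨ cong (_* x ^ suc m) (sym (ℕ→ℚ-suc (suc m))) ⟩
    ℕ→ℚ (suc (suc m)) * x ^ suc m                           ∎
    where
    open ≡-Reasoning
    lem : ∀ x c y z → z + x * (c * y) ≡ z + c * (x * y)
    lem = solve-∀ ℚ-ring
    lem′ : ∀ c z → z + c * z ≡ (1ℚ + c) * z
    lem′ = solve-∀ ℚ-ring
    null : ∀ m → shifted x m (δ₁ ∘ suc ∘ suc) ≡ 0ℚ
    null zero    = refl
    null (suc m) = trans (cong₂ (λ a b → a + x * b) (null m) (null m)) (lem″ x)
      where
      lem″ : ∀ x → 0ℚ + x * 0ℚ ≡ 0ℚ
      lem″ = solve-∀ ℚ-ring
    power : ∀ m → shifted x m (δ₁ ∘ suc) ≡ x ^ m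
    power zero    = refl
    power (suc m) = trans (cong₂ (λ a b → a + x * b) (null m) (power m))
        (trans (ℚ.+-identityˡ (x * x ^ m)) (sym (^-suc x m)))

  shifted-0 : ∀ m s → shifted 0ℚ m s ≡ s m
  shifted-0 zero    s = refl
  shifted-0 (suc m) s = trans (cong₂ _+_ (shifted-0 m (s ∘ suc)) (ℚ.*-zeroˡ (shifted 0ℚ m s))) (ℚ.+-identityʳ (s (suc m)))

  -- Here `φ` is the Bernoulli polynomial of degree m + 1, whose difference φ(i+1) - φ(i) is (m+1)
  -- i^m by `shifted-B` and `shifted-δ₁`. After telescoping, φ(0) = B_(m+1) cancels the summand k =
  -- m + 1, so the right side ends at k = m.
  faulhaber : ∀ m n → ℕ→ℚ (suc m) * Σ< n (λ i → ℕ→ℚ i ^ m) ≡ Σ< (suc m) (λ k → binom (suc m) k * B k * ℕ→ℚ n ^ (suc m ∸ k))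
  faulhaber m n = begin
    ℕ→ℚ (suc m) * Σ< n (λ i → ℕ→ℚ i ^ m)
      ≡⟨ sym (Σ-*ˡ n (ℕ→ℚ (suc m)) (λ i → ℕ→ℚ i ^ m)) ⟩
    S
      ≡⟨ lem₁ (B (suc m)) S ⟩
    B (suc m) + S - B (suc m)
      ≡⟨ cong (λ b → b + S - B (suc m)) (sym (shifted-0 (suc m) B)) ⟩
    φ 0 + S - B (suc m)
      ≡⟨ cong (_- B (suc m)) (sym (Σ-telescope n (λ i → ℕ→ℚ (suc m) * ℕ→ℚ i ^ m) φ step)) ⟩
    φ n - B (suc m)
      ≡⟨ cong (_- B (suc m)) (shifted≡Σ (ℕ→ℚ n) (suc m) B) ⟩
    T + binom (suc m) (suc m) * B (suc m) * ℕ→ℚ n ^ (m ∸ m) - B (suc m)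
      ≡⟨ cong₂ (λ b e → T + b * B (suc m) * ℕ→ℚ n ^ e - B (suc m)) (binom-diag (suc m)) (ℕ.n∸n≡0 m) ⟩
    T + 1ℚ * B (suc m) * 1ℚ - B (suc m)
      ≡⟨ lem₂ T (B (suc m)) ⟩
    T ∎
    where
    open ≡-Reasoning
    φ : ℕ → ℚ
    φ i = shifted (ℕ→ℚ i) (suc m) B
    S T : ℚ
    S = Σ< n (λ i → ℕ→ℚ (suc m) * ℕ→ℚ i ^ m)
    T = Σ< (suc m) (λ k → binom (suc m) k * B k * ℕ→ℚ n ^ (suc m ∸ k))
    lem₁ : ∀ b s → s ≡ b + s - b
    lem₁ = solve-∀ ℚ-ring
    lem₂ : ∀ t b → t + 1ℚ * b * 1ℚ - b ≡ t
    lem₂ = solve-∀ ℚ-ring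
    step : ∀ i → φ (suc i) ≡ φ i + ℕ→ℚ (suc m) * ℕ→ℚ i ^ m
    step i = begin
      shifted (ℕ→ℚ (suc i)) (suc m) B
        ≡⟨ cong (λ x → shifted x (suc m) B) (trans (ℕ→ℚ-suc i) (ℚ.+-comm 1ℚ (ℕ→ℚ i))) ⟩
      shifted (ℕ→ℚ i + 1ℚ) (suc m) B
        ≡⟨ shifted-shifted (ℕ→ℚ i) 1ℚ (suc m) B ⟩
      shifted (ℕ→ℚ i) (suc m) (λ l → shifted 1ℚ l B)
        ≡⟨ shifted-ext (ℕ→ℚ i) (suc m) shifted-B ⟩
      shifted (ℕ→ℚ i) (suc m) (λ l → B l + 1ℚ * δ₁ l)
        ≡⟨ shifted-linear (ℕ→ℚ i) (suc m) 1ℚ B δ₁ ⟩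
      φ i + 1ℚ * shifted (ℕ→ℚ i) (suc m) δ₁
        ≡⟨ cong (_+_ (φ i)) (trans (ℚ.*-identityˡ (shifted (ℕ→ℚ i) (suc m) δ₁)) (shifted-δ₁ (ℕ→ℚ i) m)) ⟩
      φ i + ℕ→ℚ (suc m) * ℕ→ℚ i ^ m ∎

  shifted-1 : ∀ x m → shifted x m (λ _ → 1ℚ) ≡ (1ℚ + x) ^ m
  shifted-1 x zero    = refl
  shifted-1 x (suc m) = trans (cong (λ t → t + x * t) (shifted-1 x m))
      (trans (lem x ((1ℚ + x) ^ m)) (sym (^-suc (1ℚ + x) m)))
    where
    lem : ∀ x y → y + x * y ≡ (1ℚ + x) * y
    lem = solve-∀ ℚ-ring

  ^-inverse : ∀ {x y} → x * y ≡ 1ℚ → ∀ e k → x ^ (e ℕ.+ k) * y ^ e ≡ x ^ k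
  ^-inverse {x} xy zero    k = ℚ.*-identityʳ (x ^ k)
  ^-inverse {x} {y} xy (suc e) k = begin
    x ^ (suc e ℕ.+ k) * y ^ suc e                ≡⟨ cong₂ _*_ (^-suc x (e ℕ.+ k)) (^-suc y e) ⟩
    (x * x ^ (e ℕ.+ k)) * (y * y ^ e)            ≡⟨ lem x y (x ^ (e ℕ.+ k)) (y ^ e) ⟩
    (x * y) * (x ^ (e ℕ.+ k) * y ^ e)            ≡⟨ cong₂ _*_ xy (^-inverse xy e k) ⟩
    1ℚ * x ^ k                                   ≡⟨ ℚ.*-identityˡ (x ^ k) ⟩
    x ^ k                                        ∎
    where
    open ≡-Reasoning
    lem : ∀ x y s t → (x * s) * (y * t) ≡ (x * y) * (s * t)
    lem = solve-∀ ℚ-ring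

  0^suc : ∀ n → 0ℚ ^ suc n ≡ 0ℚ
  0^suc n = trans (^-suc 0ℚ n) (ℚ.*-zeroˡ (0ℚ ^ n))

  -- Evaluates the coefficient C(p-2, p-5) of B_(p-5) in Faulhaber's formula for the exponent p - 3,
  -- as needed for Z.
  binom-3rd : ∀ n → ℕ→ℚ 6 * binom (3 ℕ.+ n) n ≡ ℕ→ℚ (3 ℕ.+ n) * (ℕ→ℚ (2 ℕ.+ n) * ℕ→ℚ (1 ℕ.+ n))
  binom-3rd n = third n
    where
    second : ∀ n → ℕ→ℚ 2 * binom (2 ℕ.+ n) n ≡ ℕ→ℚ (2 ℕ.+ n) * ℕ→ℚ (1 ℕ.+ n)
    second zero    = refl
    second (suc n) = trans (cong (ℕ→ℚ 2 *_) (pascal (2 ℕ.+ n) n))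
      (trans (ℚ.*-distribˡ-+ (ℕ→ℚ 2) (binom (2 ℕ.+ n) n) (binom (2 ℕ.+ n) (suc n)))
      (trans (cong₂ (λ x y → x + ℕ→ℚ 2 * y) (second n) (binom-subdiag (suc n)))
      (trans (lem (ℕ→ℚ (suc n)) (ℕ→ℚ (2 ℕ.+ n))) (cong (_* ℕ→ℚ (2 ℕ.+ n)) (sym (ℕ→ℚ-+ 2 (suc n)))))))
      where
      lem : ∀ x y → y * x + ℕ→ℚ 2 * y ≡ (ℕ→ℚ 2 + x) * y
      lem = solve-∀ ℚ-ring
    third : ∀ n → ℕ→ℚ 6 * binom (3 ℕ.+ n) n ≡ ℕ→ℚ (3 ℕ.+ n) * (ℕ→ℚ (2 ℕ.+ n) * ℕ→ℚ (1 ℕ.+ n))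
    third zero    = refl
    third (suc n) = trans (cong (ℕ→ℚ 6 *_) (pascal (3 ℕ.+ n) n))
      (trans (lem₁ (binom (3 ℕ.+ n) n) (binom (3 ℕ.+ n) (suc n)))
      (trans (cong₂ (λ x y → x + ℕ→ℚ 3 * y) (third n) (second (suc n)))
      (trans (lem₂ (ℕ→ℚ (suc n)) (ℕ→ℚ (2 ℕ.+ n)) (ℕ→ℚ (3 ℕ.+ n)))
          (cong (_* (ℕ→ℚ (3 ℕ.+ n) * ℕ→ℚ (2 ℕ.+ n))) (sym (ℕ→ℚ-+ 3 (suc n)))))))
      where
      lem₁ : ∀ x y → ℕ→ℚ 6 * (x + y) ≡ ℕ→ℚ 6 * x + ℕ→ℚ 3 * (ℕ→ℚ 2 * y)
      lem₁ = solve-∀ ℚ-ring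
      lem₂ : ∀ x y z → z * (y * x) + ℕ→ℚ 3 * (z * y) ≡ (ℕ→ℚ 3 + x) * (z * y)
      lem₂ = solve-∀ ℚ-ring

  -- Fermat's little theorem and power sums modulo p and p²

  module PowerSums (q : ℕ) (p-prime : Prime (suc q)) where
    open PIntegral (suc q) p-prime public

    private
      p : ℕ
      p = suc q

    h : ℕ → ℚ
    h e = Σ< q (λ j → v (suc j) ^ e)

    Integral-v^ : ∀ {j} e → j ℕ.< q → Integral (v (suc j) ^ e)
    Integral-v^ e j<q = Integral-^ e (Integral-v (s≤s j<q))

    Div-P : ∀ {n} x → Div n x → Div (suc n) (P * x)
    Div-P x = Div-raise 1 {x = x}

    Div-P₁ : ∀ {x} → Integral x → Div 1 (P * x)
    Div-P₁ = Div-P^ 1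

    -- By absorption C(p, k+1) = p/(k+1) · C(p-1, k), and k + 1 < p is a unit in ℤ₍ₚ₎.
    p∣binom : ∀ {k} → k ℕ.< q → Div 1 (binom p (suc k))
    p∣binom {k} k<q = Div-resp eq (Div-P₁ (Integral-* (Integral-v (s≤s k<q)) (Integral-ℕ (q C k))))
      where
      open ≡-Reasoning
      lem : ∀ P V b → P * (V * b) ≡ V * (P * b)
      lem = solve-∀ ℚ-ring
      eq : P * (v (suc k) * binom q k) ≡ binom p (suc k)
      eq = begin
        P * (v (suc k) * binom q k)                          ≡⟨ lem P (v (suc k)) (binom q k) ⟩
        v (suc k) * (P * binom q k)                          ≡⟨ cong (v (suc k) *_) (sym (binom-absorb q k)) ⟩
        v (suc k) * (ℕ→ℚ (suc k) * binom p (suc k))          ≡⟨ cancel {ℕ→ℚ (suc k)} {v (suc k)} (binom p (suc k))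
            (v-inverse k) ⟩
        binom p (suc k)                                      ∎

    -- The binomial theorem is taken from `shifted≡Σ` at the constant sequence 1, whence the factors
    -- `1ℚ`. The two end terms are x^p and 1; p divides all others.
    freshman : ∀ x → Integral x → Div 1 ((1ℚ + x) ^ p - (1ℚ + x ^ p))
    freshman x ix = Div-resp eq (Div-Σ q middle)
      where
      open ≡-Reasoning
      t : ℕ → ℚ
      t k = binom p k * 1ℚ * x ^ (p ∸ k)
      middle : ∀ k → k ℕ.< q → Div 1 (t (suc k))
      middle k k<q = Div-resp (lem (binom p (suc k)) (x ^ (q ∸ k))) (Div-scale (Integral-^ (q ∸ k) ix) (p∣binom k<q))
        where
        lem : ∀ b y → y * b ≡ b * 1ℚ * y
        lem = solve-∀ ℚ-ring
      lem₁ : ∀ y s → s ≡ 1ℚ * 1ℚ * y + s + 1ℚ * 1ℚ * 1ℚ - (1ℚ + y)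
      lem₁ = solve-∀ ℚ-ring
      eq : Σ< q (t ∘ suc) ≡ (1ℚ + x) ^ p - (1ℚ + x ^ p)
      eq = begin
        Σ< q (t ∘ suc)
          ≡⟨ lem₁ (x ^ p) (Σ< q (t ∘ suc)) ⟩
        t 0 + Σ< q (t ∘ suc) + 1ℚ * 1ℚ * x ^ 0 - (1ℚ + x ^ p)
          ≡⟨ cong₂ (λ b e → t 0 + Σ< q (t ∘ suc) + b * 1ℚ * x ^ e - (1ℚ + x ^ p)) (sym (binom-diag p)) (sym (ℕ.n∸n≡0 p)) ⟩
        t 0 + Σ< q (t ∘ suc) + t p - (1ℚ + x ^ p)
          ≡⟨ cong (λ s → s + t p - (1ℚ + x ^ p)) (sym (Σ-head q t)) ⟩
        Σ< (suc p) t - (1ℚ + x ^ p)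
          ≡⟨ cong (_- (1ℚ + x ^ p)) (trans (sym (shifted≡Σ x p (λ _ → 1ℚ))) (shifted-1 x p)) ⟩
        (1ℚ + x) ^ p - (1ℚ + x ^ p) ∎

    fermat : ∀ n → Div 1 (ℕ→ℚ n ^ p - ℕ→ℚ n)
    fermat zero    = Div-resp (sym (cong (_- 0ℚ) (0^suc q))) Div-0
    fermat (suc n) = Div-resp (trans (lem ((1ℚ + ℕ→ℚ n) ^ p) (ℕ→ℚ n ^ p) (ℕ→ℚ n)) (cong (λ x → x ^ p - x) (sym (ℕ→ℚ-suc n))))
      (Div-+ (freshman (ℕ→ℚ n) (Integral-ℕ n)) (fermat n))
      where
      lem : ∀ z y x → (z - (1ℚ + y)) + (y - x) ≡ z - (1ℚ + x)
      lem = solve-∀ ℚ-ring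

    fermat-unit : ∀ {j} → j ℕ.< q → Div 1 (ℕ→ℚ (suc j) ^ q - 1ℚ)
    fermat-unit {j} j<q = Div-resp (begin
      v (suc j) * (X ^ p - X)             ≡⟨ cong (λ t → v (suc j) * (t - X)) (^-suc X q) ⟩
      v (suc j) * (X * X ^ q - X)         ≡⟨ lem (v (suc j)) X (X ^ q) ⟩
      v (suc j) * (X * (X ^ q - 1ℚ))      ≡⟨ cancel {X} {v (suc j)} (X ^ q - 1ℚ) (v-inverse j) ⟩
      X ^ q - 1ℚ                          ∎)
      (Div-scale (Integral-v (s≤s j<q)) (fermat (suc j)))
      where
      open ≡-Reasoning
      X : ℚ
      X = ℕ→ℚ (suc j)
      lem : ∀ V X y → V * (X * y - X) ≡ V * (X * (y - 1ℚ))
      lem = solve-∀ ℚ-ring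

    -- Turns negative exponents into positive ones, to which Faulhaber's formula applies.
    v^-mod : ∀ {j} e k → e ℕ.+ k ≡ q → j ℕ.< q → Div 1 (v (suc j) ^ e - ℕ→ℚ (suc j) ^ k)
    v^-mod {j} e k e+k≡q j<q = Div-resp (begin
      V ^ e * - (X ^ q - 1ℚ)                ≡⟨ cong (λ n → V ^ e * - (X ^ n - 1ℚ)) (sym e+k≡q) ⟩
      V ^ e * - (X ^ (e ℕ.+ k) - 1ℚ)        ≡⟨ lem (V ^ e) (X ^ (e ℕ.+ k)) ⟩
      V ^ e - X ^ (e ℕ.+ k) * V ^ e         ≡⟨ cong (_-_ (V ^ e)) (^-inverse (v-inverse j) e k) ⟩
      V ^ e - X ^ k                         ∎)
      (Div-scale (Integral-v^ e j<q) (Div-neg (fermat-unit j<q)))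
      where
      open ≡-Reasoning
      X V : ℚ
      X = ℕ→ℚ (suc j)
      V = v (suc j)
      lem : ∀ y z → y * - (z - 1ℚ) ≡ y - z * y
      lem = solve-∀ ℚ-ring

    -- The recurrence obtains B_n from earlier values by dividing by n + 1, which is below p as long
    -- as n < p - 1.
    Integral-B : ∀ n → n ℕ.< q → Integral (B n)
    Integral-B n n<q = upTo n n<q n ℕ.≤-refl
      where
      upTo : ∀ n → n ℕ.< q → ∀ i → i ℕ.≤ n → Integral (B i)
      upTo zero    n<q zero    i≤n = Integral-ℕ 1
      upTo (suc n) n<q i       i≤n with ℕ.m≤n⇒m<n∨m≡n i≤n
      ... | inj₁ (s≤s i≤n′) = upTo n (ℕ.<-trans (ℕ.n<1+n n) n<q) i i≤n′
      ... | inj₂ refl       = subst Integral (sym (B-suc n)) (Integral-neg (Integral-* (Integral-Σ (suc n)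
        λ { i (s≤s i≤n′) → Integral-* (Integral-ℕ (suc (suc n) C i)) (upTo n (ℕ.<-trans (ℕ.n<1+n n) n<q) i i≤n′) })
        (Integral-v (s≤s n<q))))

    Integral-faulhaberTerm : ∀ {e} k → k ℕ.< q → Integral (binom (suc e) k * B k)
    Integral-faulhaberTerm {e} k k<q = Integral-* (Integral-ℕ (suc e C k)) (Integral-B k k<q)

    powerSum : ℕ → ℚ
    powerSum e = Σ< q (λ j → ℕ→ℚ (suc j) ^ e)

    powerSum-head : ∀ e → Σ< p (λ i → ℕ→ℚ i ^ suc e) ≡ powerSum (suc e)
    powerSum-head e = trans (Σ-head q (λ i → ℕ→ℚ i ^ suc e))
        (trans (cong (_+ powerSum (suc e)) (0^suc e)) (ℚ.+-identityˡ (powerSum (suc e))))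

    -- At n = p every term of Faulhaber's formula has at least one factor p, its Bernoulli numbers
    -- are integral, and the multiplier e + 2 on the left is a unit.
    powerSum-mod : ∀ e → suc e ℕ.< q → Div 1 (powerSum (suc e))
    powerSum-mod e e<q = Div-resp (powerSum-head e) (Div-cancel (ℕ→ℚ (suc (suc e))) (v (suc (suc e)))
        (Integral-v (s≤s e<q)) (v-inverse (suc e))
      (Div-resp (sym (faulhaber (suc e) p)) (Div-Σ (suc (suc e)) term)))
      where
      term : ∀ k → k ℕ.< suc (suc e) → Div 1 (binom (suc (suc e)) k * B k * P ^ (suc (suc e) ∸ k))
      term k (s≤s k≤e) = Div-scale (Integral-faulhaberTerm k (ℕ.≤-<-trans k≤e e<q))
        (Div-resp (trans (sym (^-suc P (suc e ∸ k))) (cong (P ^_) (sym (ℕ.+-∸-assoc 1 k≤e))))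
            (Div-P₁ (Integral-^ (suc e ∸ k) (Integral-ℕ p))))

    h-mod : ∀ e k → suc e ℕ.+ suc k ≡ q → Div 1 (h (suc e))
    h-mod e k e+k≡q = Div-resp (lem (h (suc e)) (powerSum (suc k)))
      (Div-+ (Div-Σ-cong q (λ j → v^-mod (suc e) (suc k) e+k≡q))
          (powerSum-mod k (subst (suc k ℕ.<_) e+k≡q (s≤s (ℕ.m≤n+m (suc k) e)))))
      where
      lem : ∀ x y → x - y + y ≡ x
      lem = solve-∀ ℚ-ring

    -- In Faulhaber's formula only the last summand, k = e + 1, has a single factor p; it equals
    -- (e+2) p B_(e+1), and the rest is divisible by p².
    powerSum-mod² : ∀ e → suc e ℕ.< q → Div 2 (powerSum (suc e) - P * B (suc e))
    powerSum-mod² e e<q = Div-cancel N (v (suc (suc e))) (Integral-v (s≤s e<q)) (v-inverse (suc e))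
      (Div-resp eq (Div-Σ (suc e) term))
      where
      open ≡-Reasoning
      N T : ℚ
      N = ℕ→ℚ (suc (suc e))
      f : ℕ → ℚ
      f k = binom (suc (suc e)) k * B k * P ^ (suc (suc e) ∸ k)
      T = Σ< (suc e) f
      term : ∀ k → k ℕ.< suc e → Div 2 (f k)
      term k k<e = Div-scale (Integral-faulhaberTerm k (ℕ.<-trans k<e e<q))
        (Div-resp (trans (sym (^-+ P 2 (e ∸ k))) (cong (P ^_) (sym (ℕ.+-∸-assoc 2 (ℕ.≤-pred k<e)))))
            (Div-P^ 2 (Integral-^ (e ∸ k) (Integral-ℕ p))))
      lem₁ : ∀ t n b p → t ≡ t + n * b * p - n * (p * b)
      lem₁ = solve-∀ ℚ-ring
      lem₂ : ∀ n s x → n * s - n * x ≡ n * (s - x)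
      lem₂ = solve-∀ ℚ-ring
      eq : T ≡ N * (powerSum (suc e) - P * B (suc e))
      eq = begin
        T
          ≡⟨ lem₁ T N (B (suc e)) P ⟩
        T + N * B (suc e) * P ^ 1 - N * (P * B (suc e))
          ≡⟨ cong₂ (λ b i → T + b * B (suc e) * P ^ i - N * (P * B (suc e))) (sym (binom-subdiag (suc e)))
              (sym (trans (ℕ.+-∸-assoc 1 (ℕ.≤-refl {suc e})) (cong suc (ℕ.n∸n≡0 e)))) ⟩
        T + f (suc e) - N * (P * B (suc e))
          ≡⟨ cong (_- N * (P * B (suc e))) (sym (faulhaber (suc e) p)) ⟩
        N * Σ< p (λ i → ℕ→ℚ i ^ suc e) - N * (P * B (suc e))
          ≡⟨ cong (λ s → N * s - N * (P * B (suc e))) (powerSum-head e) ⟩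
        N * powerSum (suc e) - N * (P * B (suc e))
          ≡⟨ lem₂ N (powerSum (suc e)) (P * B (suc e)) ⟩
        N * (powerSum (suc e) - P * B (suc e)) ∎

  -- Reflection and folding of power sums

  Σ-linear : ∀ n c f g → Σ< n (λ i → f i + c * g i) ≡ Σ< n f + c * Σ< n g
  Σ-linear n c f g = trans (Σ-+ n f (λ i → c * g i)) (cong (_+_ (Σ< n f)) (Σ-*ˡ n c g))

  Σ-split : ∀ m n f → Σ< (m ℕ.+ n) f ≡ Σ< m f + Σ< n (λ i → f (m ℕ.+ i))
  Σ-split m zero    f = trans (cong (λ k → Σ< k f) (ℕ.+-identityʳ m)) (sym (ℚ.+-identityʳ (Σ< m f)))
  Σ-split m (suc n) f = trans (cong (λ k → Σ< k f) (ℕ.+-suc m n)) (trans (cong (_+ f (m ℕ.+ n)) (Σ-split m n f))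
    (ℚ.+-assoc (Σ< m f) (Σ< n (λ i → f (m ℕ.+ i))) (f (m ℕ.+ n))))

  Σ-parity : ∀ n (f : ℕ → ℚ) → Σ< (n ℕ.+ n) f ≡ Σ< n (λ i → f (suc (i ℕ.+ i))) + Σ< n (λ i → f (i ℕ.+ i))
  Σ-parity zero    f = refl
  Σ-parity (suc n) f = trans (cong (λ k → Σ< k f) (cong suc (ℕ.+-suc n n)))
    (trans (cong (λ s → s + f (n ℕ.+ n) + f (suc (n ℕ.+ n))) (Σ-parity n f))
    (lem (Σ< n (λ i → f (suc (i ℕ.+ i)))) (Σ< n (λ i → f (i ℕ.+ i))) (f (n ℕ.+ n)) (f (suc (n ℕ.+ n)))))
    where
    lem : ∀ a b c d → a + b + c + d ≡ a + d + (b + c)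
    lem = solve-∀ ℚ-ring

  -- A linear form in the entries of `y` from index e on. It is evaluated both at the powers of one
  -- reciprocal and at the sums `h`, so that a congruence for single terms passes to the sums by
  -- linearity.
  combination : List ℚ → ℕ → (ℕ → ℚ) → ℚ
  combination []       e y = 0ℚ
  combination (c ∷ cs) e y = combination cs (suc e) y + c * y e

  Σ-combination : ∀ n cs e (y : ℕ → ℕ → ℚ) → Σ< n (λ j → combination cs e (y j)) ≡ combination cs e
      (λ k → Σ< n (λ j → y j k))
  Σ-combination n []       e y = Σ-zero n
  Σ-combination n (c ∷ cs) e y = trans (Σ-linear n c (λ j → combination cs (suc e) (y j)) (λ j → y j e))
    (cong (_+ c * Σ< n (λ j → y j e)) (Σ-combination n cs (suc e) y))

  module Reflection (q : ℕ) (p-prime : Prime (suc q)) where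
    open PowerSums q p-prime public

    -- 1/x + 1/(p-x) = p/(x(p-x))
    v-reflect : ∀ x y → suc x ℕ.+ suc y ≡ suc q → v (suc y) ≡ P * (v (suc x) * v (suc y)) - v (suc x)
    v-reflect x y x+y≡p = begin
      b                         ≡⟨ lem₁ a b ⟩
      a * 1ℚ + 1ℚ * b - a       ≡⟨ cong₂ (λ s t → a * s + t * b - a) (sym (v-inverse y)) (sym (v-inverse x)) ⟩
      a * (Y * b) + (X * a) * b - a ≡⟨ lem₂ X Y a b ⟩
      (X + Y) * (a * b) - a     ≡⟨ cong (λ s → s * (a * b) - a) (trans (sym (ℕ→ℚ-+ (suc x) (suc y))) (cong ℕ→ℚ x+y≡p)) ⟩
      P * (a * b) - a           ∎
      where
      open ≡-Reasoning
      X Y a b : ℚ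
      X = ℕ→ℚ (suc x)
      Y = ℕ→ℚ (suc y)
      a = v (suc x)
      b = v (suc y)
      lem₁ : ∀ a b → b ≡ a * 1ℚ + 1ℚ * b - a
      lem₁ = solve-∀ ℚ-ring
      lem₂ : ∀ X Y a b → a * (Y * b) + (X * a) * b - a ≡ (X + Y) * (a * b) - a
      lem₂ = solve-∀ ℚ-ring

    complement : ∀ {j} → j ℕ.< q → suc j ℕ.+ suc (q ∸ suc j) ≡ suc q
    complement {j} j<q = cong suc (trans (ℕ.+-suc j (q ∸ suc j)) (ℕ.m+[n∸m]≡n j<q))

    h-reflect : ∀ n e cs → (∀ a b → Integral a → Integral b → b ≡ P * (a * b) - a → Div n
        (b ^ e - combination cs e (a ^_))) →
      Div n (h e - combination cs e h)
    h-reflect n e cs local = Div-resp (cong₂ _-_ (sym (Σ-reverse q (λ i → v i ^ e)))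
        (Σ-combination q cs e (λ j → v (suc j) ^_)))
      (Div-Σ-cong q term)
      where
      term : ∀ j → j ℕ.< q → Div n (v (q ∸ j) ^ e - combination cs e (v (suc j) ^_))
      term j j<q = subst (λ y → Div n (v y ^ e - combination cs e (v (suc j) ^_))) (sym (ℕ.+-∸-assoc 1 j<q))
        (local (v (suc j)) (v (suc y)) (Integral-v (s≤s j<q)) (Integral-v (s≤s y<q)) (v-reflect j y (complement j<q)))
        where
        y : ℕ
        y = q ∸ suc j
        y<q : y ℕ.< q
        y<q = subst (ℕ._≤ q) (ℕ.+-∸-assoc 1 j<q) (ℕ.m∸n≤m q j)

    -- With a = 1/x, the reciprocal b = 1/(p-x) is the geometric series -a(1 + pa + p²a² + ...).
    -- Stopped after five terms, it has the exact remainder p⁵a⁵b.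
    h₁-relation : Div 5 (ℕ→ℚ 2 * h 1 + P * h 2 + P ^ 2 * h 3 + P ^ 3 * h 4 + P ^ 4 * h 5)
    h₁-relation = Div-resp (collect P (h 1) (h 2) (h 3) (h 4) (h 5))
      (h-reflect 5 1 (- 1ℚ ∷ - P ∷ - (P ^ 2) ∷ - (P ^ 3) ∷ - (P ^ 4) ∷ [])
        λ a b ia ib b≡ → Div-resp
          (sym (trans (geometric P a b) (trans (cong (λ t → P ^ 5 * (a ^ 5 * b) + (b - t) *
              (1ℚ + P * a + P ^ 2 * a ^ 2 + P ^ 3 * a ^ 3 + P ^ 4 * a ^ 4)) (sym b≡))
            (absorb (P ^ 5 * (a ^ 5 * b)) b (1ℚ + P * a + P ^ 2 * a ^ 2 + P ^ 3 * a ^ 3 + P ^ 4 * a ^ 4)))))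
          (Div-P^ 5 (Integral-* (Integral-^ 5 ia) ib)))
      where
      geometric : ∀ P a b → b ^ 1 - (0ℚ + - (P ^ 4) * a ^ 5 + - (P ^ 3) * a ^ 4 + - (P ^ 2) * a ^ 3 + - P * a ^ 2 +
          - 1ℚ * a ^ 1)
        ≡ P ^ 5 * (a ^ 5 * b) + (b - (P * (a * b) - a)) * (1ℚ + P * a + P ^ 2 * a ^ 2 + P ^ 3 * a ^ 3 + P ^ 4 * a ^ 4)
      geometric = solve-∀ ℚ-ring
      absorb : ∀ x b y → x + (b - b) * y ≡ x
      absorb = solve-∀ ℚ-ring
      collect : ∀ P h₁ h₂ h₃ h₄ h₅ → h₁ - (0ℚ + - (P ^ 4) * h₅ + - (P ^ 3) * h₄ + - (P ^ 2) * h₃ + - P * h₂ + - 1ℚ * h₁)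
        ≡ ℕ→ℚ 2 * h₁ + P * h₂ + P ^ 2 * h₃ + P ^ 3 * h₄ + P ^ 4 * h₅
      collect = solve-∀ ℚ-ring

    -- Cubing the same series gives b³ = -a³(1 - pa)⁻³, and 1, 3, 6 are the first coefficients of (1
    -- - u)⁻³. In `cube` the remainder a³b is kept as an opaque `t`, which leaves an explicit
    -- quotient by p³.
    h₃-relation : Div 3 (ℕ→ℚ 2 * h 3 + ℕ→ℚ 3 * P * h 4 + ℕ→ℚ 6 * P ^ 2 * h 5)
    h₃-relation = Div-resp (collect P (h 3) (h 4) (h 5))
      (h-reflect 3 3 (- 1ℚ ∷ - (ℕ→ℚ 3 * P) ∷ - (ℕ→ℚ 6 * P ^ 2) ∷ [])
        λ a b ia ib b≡ → let t = a ^ 3 * b; it = Integral-* (Integral-^ 3 ia) ib in Div-resp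
          (sym (trans (cong (λ z → z ^ 3 - combination (- 1ℚ ∷ - (ℕ→ℚ 3 * P) ∷ - (ℕ→ℚ 6 * P ^ 2) ∷ []) 3 (a ^_))
              (expand a b b≡)) (cube P a t)))
          (Div-P^ 3 (integralQuotient ia it)))
      where
      c : ℚ → ℚ
      c a = - (a + P * a ^ 2 + P ^ 2 * a ^ 3)
      expand : ∀ a b → b ≡ P * (a * b) - a → b ≡ c a + P ^ 3 * (a ^ 3 * b)
      expand a b b≡ = trans (lem P a b) (trans (cong (λ t → c a + P ^ 3 * (a ^ 3 * b) + (b - t) *
          (1ℚ + P * a + P ^ 2 * a ^ 2)) (sym b≡)) (absorb (c a + P ^ 3 * (a ^ 3 * b)) b (1ℚ + P * a + P ^ 2 * a ^ 2)))
        where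
        lem : ∀ P a b → b ≡ - (a + P * a ^ 2 + P ^ 2 * a ^ 3) + P ^ 3 * (a ^ 3 * b) + (b - (P * (a * b) - a)) *
            (1ℚ + P * a + P ^ 2 * a ^ 2)
        lem = solve-∀ ℚ-ring
        absorb : ∀ x b y → x + (b - b) * y ≡ x
        absorb = solve-∀ ℚ-ring
      cube : ∀ P a t → (- (a + P * a ^ 2 + P ^ 2 * a ^ 3) + P ^ 3 * t) ^ 3
          - (0ℚ + - (ℕ→ℚ 6 * P ^ 2) * a ^ 5 + - (ℕ→ℚ 3 * P) * a ^ 4 + - 1ℚ * a ^ 3)
        ≡ P ^ 3 * (- (a ^ 6 * (ℕ→ℚ 7 + ℕ→ℚ 6 * (P * a) + ℕ→ℚ 3 * (P * a) ^ 2 + (P * a) ^ 3))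
          + (ℕ→ℚ 3 * (a + P * a ^ 2 + P ^ 2 * a ^ 3) ^ 2 * t - ℕ→ℚ 3 * (a + P * a ^ 2 + P ^ 2 * a ^ 3) * P ^ 3 * t
              ^ 2 + P ^ 6 * t ^ 3))
      cube = solve-∀ ℚ-ring
      iP : Integral P
      iP = Integral-ℕ (suc q)
      integralQuotient : ∀ {a t} → Integral a → Integral t → Integral
          (- (a ^ 6 * (ℕ→ℚ 7 + ℕ→ℚ 6 * (P * a) + ℕ→ℚ 3 * (P * a) ^ 2 + (P * a) ^ 3))
          + (ℕ→ℚ 3 * (a + P * a ^ 2 + P ^ 2 * a ^ 3) ^ 2 * t - ℕ→ℚ 3 * (a + P * a ^ 2 + P ^ 2 * a ^ 3) * P ^ 3 * t
              ^ 2 + P ^ 6 * t ^ 3))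
      integralQuotient {a} {t} ia it = Integral-+
        (Integral-neg (Integral-* (Integral-^ 6 ia) (Integral-+
            (Integral-+ (Integral-+ (Integral-ℕ 7) (Integral-* (Integral-ℕ 6) iPa))
            (Integral-* (Integral-ℕ 3) (Integral-^ 2 iPa))) (Integral-^ 3 iPa))))
        (Integral-+ (Integral-- (Integral-* (Integral-* (Integral-ℕ 3) (Integral-^ 2 ic)) it)
          (Integral-* (Integral-* (Integral-* (Integral-ℕ 3) ic) (Integral-^ 3 iP)) (Integral-^ 2 it)))
          (Integral-* (Integral-^ 6 iP) (Integral-^ 3 it)))
        where
        iPa : Integral (P * a)
        iPa = Integral-* iP ia
        ic : Integral (a + P * a ^ 2 + P ^ 2 * a ^ 3)
        ic = Integral-+ (Integral-+ ia (Integral-* iP (Integral-^ 2 ia))) (Integral-* (Integral-^ 2 iP) (Integral-^ 3 ia))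
      collect : ∀ P h₃ h₄ h₅ → h₃ - (0ℚ + - (ℕ→ℚ 6 * P ^ 2) * h₅ + - (ℕ→ℚ 3 * P) * h₄ + - 1ℚ * h₃)
        ≡ ℕ→ℚ 2 * h₃ + ℕ→ℚ 3 * P * h₄ + ℕ→ℚ 6 * P ^ 2 * h₅
      collect = solve-∀ ℚ-ring

    -- Both halves of the sum of f are compared with the lower half: once by x ↦ p - x on the upper half,
    -- and once by splitting into even arguments 2x and odd arguments p - 2x.
    halves : ∀ n → n ℕ.+ n ≡ q → (f g : ℕ → ℚ) (c : ℚ) → Integral c →
      (∀ x y → suc x ℕ.+ suc y ≡ suc q → Div 2 (f (suc y) - (f (suc x) + P * g (suc x)))) →
      (∀ x → f (suc x ℕ.+ suc x) ≡ c * f (suc x)) → (∀ x → ℕ→ℚ 2 * g (suc x ℕ.+ suc x) ≡ c * g (suc x)) →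
      Div 2 (ℕ→ℚ 2 * (c - 1ℚ) * Σ< q (f ∘ suc) - P * (c * Σ< n (g ∘ suc)))
    halves n n+n≡q f g c ic reflect f-double g-double =
      -- Write S for the whole sum. The two folds say S ≡ 2·lower + p·G₁ and S ≡ 2c·lower + p·G₂.
      -- Taking 2c times the first minus twice the second eliminates `lower`, and 2·G₂ = c·G₁ merges
      -- the rest.
      Div-resp conclude (Div-- (Div-scale (Integral-* (Integral-ℕ 2) ic) upper) (Div-scale (Integral-ℕ 2) odds))
      where
      open ≡-Reasoning
      lower upperSum evens oddSum G₁ G₂ : ℚ
      lower    = Σ< n (f ∘ suc)
      upperSum = Σ< n (λ i → f (suc (n ℕ.+ i)))
      evens    = Σ< n (λ i → f (suc (suc (i ℕ.+ i))))
      oddSum   = Σ< n (λ i → f (suc (i ℕ.+ i)))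
      G₁       = Σ< n (g ∘ suc)
      G₂       = Σ< n (λ i → g (suc i ℕ.+ suc i))

      whole₁ : Σ< q (f ∘ suc) ≡ lower + upperSum
      whole₁ = trans (cong (λ k → Σ< k (f ∘ suc)) (sym n+n≡q)) (Σ-split n n (f ∘ suc))

      whole₂ : Σ< q (f ∘ suc) ≡ evens + oddSum
      whole₂ = trans (cong (λ k → Σ< k (f ∘ suc)) (sym n+n≡q)) (Σ-parity n (f ∘ suc))

      evens≡ : evens ≡ c * lower
      evens≡ = trans (Σ-ext n (λ i → trans (cong f (sym (cong suc (ℕ.+-suc i i)))) (f-double i))) (Σ-*ˡ n c (f ∘ suc))

      G₂≡ : ℕ→ℚ 2 * G₂ ≡ c * G₁
      G₂≡ = trans (sym (Σ-*ˡ n (ℕ→ℚ 2) _)) (trans (Σ-ext n g-double) (Σ-*ˡ n c (g ∘ suc)))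

      n∸ : ∀ {i} → i ℕ.< n → n ∸ i ≡ suc (n ∸ suc i)
      n∸ i<n = ℕ.+-∸-assoc 1 i<n

      upper : Div 2 (upperSum - (lower + P * G₁))
      upper = Div-resp (cong₂ _-_
          (trans (sym (Σ-reverse n (λ k → f (n ℕ.+ k)))) (Σ-ext n (λ i → cong f (ℕ.+-suc n i))))
          (Σ-linear n P (f ∘ suc) (g ∘ suc)))
        (Div-Σ-cong n λ i i<n → subst (λ k → Div 2 (f k - (f (suc i) + P * g (suc i))))
            (sym (trans (cong (n ℕ.+_) (n∸ i<n)) (ℕ.+-suc n (n ∸ suc i))))
          (reflect i (n ℕ.+ (n ∸ suc i)) (total i i<n)))
        where
        total : ∀ i → i ℕ.< n → suc i ℕ.+ suc (n ℕ.+ (n ∸ suc i)) ≡ suc q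
        total i i<n = trans (cong suc (trans (ℕ.+-suc i (n ℕ.+ k))
            (trans (ℕ.+-comm (suc i) (n ℕ.+ k)) (trans (ℕ.+-assoc n k (suc i)) (cong (n ℕ.+_) (ℕ.m∸n+n≡m i<n))))))
            (cong suc n+n≡q)
          where
          k : ℕ
          k = n ∸ suc i

      odds : Div 2 (oddSum - (evens + P * G₂))
      odds = Div-resp (cong₂ _-_
          -- Read backwards, the odd arguments are 2(n-i) - 1 = p - 2(i+1), because 2n = p - 1.
          (trans (sym (Σ-reverse n (λ k → f (k ℕ.+ k ∸ 1)))) (Σ-ext n (λ i → cong f (ℕ.+-suc i i))))
          (trans (Σ-linear n P (λ i → f (suc i ℕ.+ suc i)) (λ i → g (suc i ℕ.+ suc i)))
              (cong (_+ P * G₂) (Σ-ext n (λ i → cong f (cong suc (ℕ.+-suc i i)))))))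
        (Div-Σ-cong n λ i i<n → subst (λ k → Div 2 (f (k ℕ.+ k ∸ 1) -
            (f (suc i ℕ.+ suc i) + P * g (suc i ℕ.+ suc i)))) (sym (n∸ i<n))
          (subst (λ y → Div 2 (f y - (f (suc i ℕ.+ suc i) + P * g (suc i ℕ.+ suc i))))
              (sym (ℕ.+-suc (n ∸ suc i) (n ∸ suc i)))
          (reflect (i ℕ.+ suc i) ((n ∸ suc i) ℕ.+ (n ∸ suc i)) (total i i<n))))
        where
        total : ∀ i → i ℕ.< n → suc (i ℕ.+ suc i) ℕ.+ suc ((n ∸ suc i) ℕ.+ (n ∸ suc i)) ≡ suc q
        total i i<n = trans (arith i (n ∸ suc i)) (trans (cong (λ k → suc (k ℕ.+ k)) (ℕ.m∸n+n≡m i<n)) (cong suc n+n≡q))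
          where
          arith : ∀ i k → suc (i ℕ.+ suc i) ℕ.+ suc (k ℕ.+ k) ≡ suc ((k ℕ.+ suc i) ℕ.+ (k ℕ.+ suc i))
          arith = ℕ-solve-∀

      S : ℚ
      S = Σ< q (f ∘ suc)
      conclude : ℕ→ℚ 2 * c * (upperSum - (lower + P * G₁)) - ℕ→ℚ 2 * (oddSum - (evens + P * G₂)) ≡ ℕ→ℚ 2 * (c - 1ℚ)
          * S - P * (c * G₁)
      conclude = begin
        ℕ→ℚ 2 * c * (upperSum - (lower + P * G₁)) - ℕ→ℚ 2 * (oddSum - (evens + P * G₂))
          ≡⟨ lem₁ c P lower upperSum evens oddSum G₁ G₂ ⟩
        ℕ→ℚ 2 * c * (lower + upperSum - (ℕ→ℚ 2 * lower + P * G₁)) - ℕ→ℚ 2 * (evens + oddSum - ℕ→ℚ 2 * evens) + P *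
            (ℕ→ℚ 2 * G₂)
          ≡⟨ cong₂ (λ s t → ℕ→ℚ 2 * c * (s - (ℕ→ℚ 2 * lower + P * G₁)) - ℕ→ℚ 2 * (t - ℕ→ℚ 2 * evens) + P *
              (ℕ→ℚ 2 * G₂)) (sym whole₁) (sym whole₂) ⟩
        ℕ→ℚ 2 * c * (S - (ℕ→ℚ 2 * lower + P * G₁)) - ℕ→ℚ 2 * (S - ℕ→ℚ 2 * evens) + P * (ℕ→ℚ 2 * G₂)
          ≡⟨ cong₂ (λ s t → ℕ→ℚ 2 * c * (S - (ℕ→ℚ 2 * lower + P * G₁)) - ℕ→ℚ 2 * (S - ℕ→ℚ 2 * s) + P * t) evens≡ G₂≡ ⟩
        ℕ→ℚ 2 * c * (S - (ℕ→ℚ 2 * lower + P * G₁)) - ℕ→ℚ 2 * (S - ℕ→ℚ 2 * (c * lower)) + P * (c * G₁)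
          ≡⟨ lem₂ c P S lower G₁ ⟩
        ℕ→ℚ 2 * (c - 1ℚ) * S - P * (c * G₁) ∎
        where
        lem₁ : ∀ c P l u e o g₁ g₂ → ℕ→ℚ 2 * c * (u - (l + P * g₁)) - ℕ→ℚ 2 * (o - (e + P * g₂))
          ≡ ℕ→ℚ 2 * c * (l + u - (ℕ→ℚ 2 * l + P * g₁)) - ℕ→ℚ 2 * (e + o - ℕ→ℚ 2 * e) + P * (ℕ→ℚ 2 * g₂)
        lem₁ = solve-∀ ℚ-ring
        lem₂ : ∀ c P S l g₁ → ℕ→ℚ 2 * c * (S - (ℕ→ℚ 2 * l + P * g₁)) - ℕ→ℚ 2 * (S - ℕ→ℚ 2 * (c * l)) + P * (c * g₁)
          ≡ ℕ→ℚ 2 * (c - 1ℚ) * S - P * (c * g₁)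
        lem₂ = solve-∀ ℚ-ring

  -- Halving the range: h₄ modulo p²

  ^-distrib-* : ∀ x y n → (x * y) ^ n ≡ x ^ n * y ^ n
  ^-distrib-* x y zero    = refl
  ^-distrib-* x y (suc n) = trans (^-suc (x * y) n) (trans (cong (x * y *_) (^-distrib-* x y n))
    (trans (lem x y (x ^ n) (y ^ n)) (sym (cong₂ _*_ (^-suc x n) (^-suc y n)))))
    where
    lem : ∀ x y s t → x * y * (s * t) ≡ x * s * (y * t)
    lem = solve-∀ ℚ-ring

  ½ : ℚ
  ½ = v 2

  v-double : ∀ x → v (suc x ℕ.+ suc x) ≡ ½ * v (suc x)
  v-double x = begin
    b                          ≡⟨ lem₁ b ⟩
    ½ * (ℕ→ℚ 2 * b) * 1ℚ       ≡⟨ cong (½ * (ℕ→ℚ 2 * b) *_) (sym (v-inverse x)) ⟩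
    ½ * (ℕ→ℚ 2 * b) * (X * a)  ≡⟨ lem₂ X a b ⟩
    ½ * a * ((X + X) * b)      ≡⟨ cong (½ * a *_) (trans (cong (_* b) (sym (ℕ→ℚ-+ (suc x) (suc x))))
        (v-inverse (x ℕ.+ suc x))) ⟩
    ½ * a * 1ℚ                 ≡⟨ ℚ.*-identityʳ (½ * a) ⟩
    ½ * a                      ∎
    where
    open ≡-Reasoning
    X a b : ℚ
    X = ℕ→ℚ (suc x)
    a = v (suc x)
    b = v (suc x ℕ.+ suc x)
    lem₁ : ∀ b → b ≡ ½ * (ℕ→ℚ 2 * b) * 1ℚ
    lem₁ = solve-∀ ℚ-ring
    lem₂ : ∀ X a b → ½ * (ℕ→ℚ 2 * b) * (X * a) ≡ ½ * a * ((X + X) * b)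
    lem₂ = solve-∀ ℚ-ring

  -- Here m = p - 5 is even and positive, so p ≥ 7 and the constants 2, 3 and 5 are units.
  module HalfSums (s : ℕ) (p-prime : Prime (5 ℕ.+ (suc s ℕ.+ suc s))) where
    m q : ℕ
    m = suc s ℕ.+ suc s
    q = 4 ℕ.+ m

    open Reflection q p-prime public

    iP : Integral P
    iP = Integral-ℕ (suc q)

    m<q : m ℕ.< q
    m<q = s≤s (ℕ.m≤n+m m 3)

    Integral-½ : Integral ½
    Integral-½ = Integral-v {1} (s≤s (s≤s (s≤s z≤n)))

    Integral-⅓ : Integral (v 3)
    Integral-⅓ = Integral-v {2} (s≤s (s≤s (s≤s (s≤s z≤n))))

    Integral-⅕ : Integral (v 5)
    Integral-⅕ = Integral-v {4} (s≤s (s≤s (s≤s (s≤s (s≤s (s≤s z≤n))))))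

    M : ℚ
    M = ℕ→ℚ m

    P≡5+M : P ≡ ℕ→ℚ 5 + M
    P≡5+M = ℕ→ℚ-+ 5 m

    T : ℚ
    T = Σ< (2 ℕ.+ suc s) (λ i → v (suc i) ^ 5)

    half : (2 ℕ.+ suc s) ℕ.+ (2 ℕ.+ suc s) ≡ q
    half = arith s
      where
      arith : ∀ s → (2 ℕ.+ suc s) ℕ.+ (2 ℕ.+ suc s) ≡ 4 ℕ.+ (suc s ℕ.+ suc s)
      arith = ℕ-solve-∀

    half<q : ∀ {i} → i ℕ.< 2 ℕ.+ suc s → i ℕ.< q
    half<q i<n = ℕ.<-≤-trans i<n (ℕ.+-mono-≤ {2} {4} (s≤s (s≤s z≤n)) (ℕ.m≤m+n (suc s) (suc s)))

    Integral-T : Integral T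
    Integral-T = Integral-Σ (2 ℕ.+ suc s) (λ i i<n → Integral-v^ 5 (half<q i<n))

    -- `halves` with c = 2⁻⁴, because (p-x)⁻⁴ ≡ x⁻⁴ + 4p x⁻⁵ modulo p². The multiplier -16 clears c,
    -- and 30 = 2(2⁴ - 1).
    h₄-half : Div 2 (ℕ→ℚ 30 * h 4 + ℕ→ℚ 4 * P * T)
    h₄-half = Div-resp (trans (cong (λ t → - (ℕ→ℚ 16) * (ℕ→ℚ 2 * (½ ^ 4 - 1ℚ) * h 4 - P * (½ ^ 4 * t)))
        (Σ-*ˡ (2 ℕ.+ suc s) (ℕ→ℚ 4) (λ i → v (suc i) ^ 5))) (collect P (h 4) T))
      (Div-scale (Integral-neg (Integral-ℕ 16)) (halves (2 ℕ.+ suc s) half (λ i → v i ^ 4) (λ i → ℕ→ℚ 4 * v i ^ 5)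
          (½ ^ 4) (Integral-^ 4 Integral-½)
        reflect (λ x → trans (cong (_^ 4) (v-double x)) (double₄ (v (suc x))))
            (λ x → trans (cong (λ y → ℕ→ℚ 2 * (ℕ→ℚ 4 * y ^ 5)) (v-double x)) (double₅ (v (suc x))))))
      where
      collect : ∀ P h t → - (ℕ→ℚ 16) * (ℕ→ℚ 2 * (½ ^ 4 - 1ℚ) * h - P * (½ ^ 4 * (ℕ→ℚ 4 * t))) ≡ ℕ→ℚ 30 * h + ℕ→ℚ 4 * P * t
      collect = solve-∀ ℚ-ring
      double₄ : ∀ a → (½ * a) ^ 4 ≡ ½ ^ 4 * a ^ 4
      double₄ = solve-∀ ℚ-ring
      double₅ : ∀ a → ℕ→ℚ 2 * (ℕ→ℚ 4 * (½ * a) ^ 5) ≡ ½ ^ 4 * (ℕ→ℚ 4 * a ^ 5)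
      double₅ = solve-∀ ℚ-ring
      -- The exact quotient of b⁴ - a⁴ - 4pa⁵ by p², after substituting b = -(a + pa²) + p²·a²b.
      R : ℚ → ℚ → ℚ
      R a b = ℕ→ℚ 6 * a ^ 6 + ℕ→ℚ 4 * P * a ^ 7 + P ^ 2 * a ^ 8 - ℕ→ℚ 4 * (a + P * a ^ 2) ^ 3 * (a ^ 2 * b)
        + ℕ→ℚ 6 * (a + P * a ^ 2) ^ 2 * P ^ 2 * (a ^ 2 * b) ^ 2 - ℕ→ℚ 4 * (a + P * a ^ 2) * P ^ 4 * (a ^ 2 * b) ^ 3
            + P ^ 6 * (a ^ 2 * b) ^ 4
      Integral-R : ∀ {a b} → Integral a → Integral b → Integral (R a b)
      Integral-R {a} {b} ia ib = Integral-+ (Integral-- (Integral-+ (Integral-- (Integral-+ (Integral-+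
        (Integral-* (Integral-ℕ 6) (Integral-^ 6 ia)) (Integral-* (Integral-* (Integral-ℕ 4) iP)
            (Integral-^ 7 ia))) (Integral-* (Integral-^ 2 iP) (Integral-^ 8 ia)))
        (Integral-* (Integral-* (Integral-ℕ 4) (Integral-^ 3 ic)) it))
        (Integral-* (Integral-* (Integral-* (Integral-ℕ 6) (Integral-^ 2 ic)) (Integral-^ 2 iP)) (Integral-^ 2 it)))
        (Integral-* (Integral-* (Integral-* (Integral-ℕ 4) ic) (Integral-^ 4 iP)) (Integral-^ 3 it)))
        (Integral-* (Integral-^ 6 iP) (Integral-^ 4 it))
        where
        ic : Integral (a + P * a ^ 2)
        ic = Integral-+ ia (Integral-* iP (Integral-^ 2 ia))
        it : Integral (a ^ 2 * b)
        it = Integral-* (Integral-^ 2 ia) ib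
      reflect : ∀ x y → suc x ℕ.+ suc y ≡ suc q → Div 2 (v (suc y) ^ 4 - (v (suc x) ^ 4 + P * (ℕ→ℚ 4 * v (suc x) ^ 5)))
      reflect x y x+y≡p = Div-resp (sym (trans (cong (λ z → z ^ 4 - (a ^ 4 + P * (ℕ→ℚ 4 * a ^ 5))) expand)
          (fourth P a (a ^ 2 * b)))) (Div-P^ 2 (Integral-R ia ib))
        where
        a b : ℚ
        a = v (suc x)
        b = v (suc y)
        ia : Integral a
        ia = Integral-v (subst (suc x ℕ.<_) x+y≡p (ℕ.m<m+n (suc x) (s≤s z≤n)))
        ib : Integral b
        ib = Integral-v (subst (suc y ℕ.<_) x+y≡p (ℕ.m<n+m (suc y) (s≤s z≤n)))
        expand : b ≡ - (a + P * a ^ 2) + P ^ 2 * (a ^ 2 * b)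
        expand = trans (lem P a b) (trans (cong (λ t → - (a + P * a ^ 2) + P ^ 2 * (a ^ 2 * b) + (b - t) *
            (1ℚ + P * a)) (sym (v-reflect x y x+y≡p)))
          (absorb (- (a + P * a ^ 2) + P ^ 2 * (a ^ 2 * b)) b (1ℚ + P * a)))
          where
          lem : ∀ P a b → b ≡ - (a + P * a ^ 2) + P ^ 2 * (a ^ 2 * b) + (b - (P * (a * b) - a)) * (1ℚ + P * a)
          lem = solve-∀ ℚ-ring
          absorb : ∀ x b y → x + (b - b) * y ≡ x
          absorb = solve-∀ ℚ-ring
        fourth : ∀ P a t → (- (a + P * a ^ 2) + P ^ 2 * t) ^ 4 - (a ^ 4 + P * (ℕ→ℚ 4 * a ^ 5))
          ≡ P ^ 2 * (ℕ→ℚ 6 * a ^ 6 + ℕ→ℚ 4 * P * a ^ 7 + P ^ 2 * a ^ 8 - ℕ→ℚ 4 * (a + P * a ^ 2) ^ 3 * t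
            + ℕ→ℚ 6 * (a + P * a ^ 2) ^ 2 * P ^ 2 * t ^ 2 - ℕ→ℚ 4 * (a + P * a ^ 2) * P ^ 4 * t ^ 3 + P ^ 6 * t ^ 4)
        fourth = solve-∀ ℚ-ring

    -- The first two terms of (p - X)^k for even k. Induction in steps of two keeps the sign of X^k
    -- positive, and writing X^(k-1) as X^k · a avoids a predecessor in the exponent.
    evenPower-reflect : ∀ {X Y a} → Integral X → Integral a → X * a ≡ 1ℚ → Integral Y → Y ≡ P - X → ∀ t →
      Div 2 (Y ^ (t ℕ.+ t) - (X ^ (t ℕ.+ t) + P * (- ℕ→ℚ (t ℕ.+ t) * (X ^ (t ℕ.+ t) * a))))
    evenPower-reflect {X} {Y} {a} iX ia Xa iY Y≡ zero    = Div-resp (lem P a) Div-0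
      where
      lem : ∀ P a → 0ℚ ≡ 1ℚ - (1ℚ + P * (- 0ℚ * (1ℚ * a)))
      lem = solve-∀ ℚ-ring
    evenPower-reflect {X} {Y} {a} iX ia Xa iY Y≡ (suc t) =
      subst (λ k → Div 2 (Y ^ k - (X ^ k + P * (- ℕ→ℚ k * (X ^ k * a))))) (sym (cong suc (ℕ.+-suc t t)))
        (Div-resp conclude (Div-+ (Div-scale (Integral-^ 2 iY) (evenPower-reflect iX ia Xa iY Y≡ t))
          (Div-P^ 2 (Integral-* (Integral-^ e iX) (Integral-+
              (Integral-- (Integral-ℕ 1) (Integral-* (Integral-* (Integral-ℕ e) iP) ia))
              (Integral-* (Integral-ℕ 2) (Integral-ℕ e)))))))
      where
      open ≡-Reasoning
      e : ℕ
      e = t ℕ.+ t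
      E u y r : ℚ
      E = ℕ→ℚ e
      u = X ^ e
      y = Y ^ e
      r = u * (1ℚ - E * P * a + ℕ→ℚ 2 * E)
      lem₁ : ∀ P X a E u y → (P - X) ^ 2 * (y - (u + P * (- E * (u * a)))) + P ^ 2 * (u * (1ℚ - E * P * a + ℕ→ℚ 2 * E))
        ≡ (P - X) ^ 2 * y - (X ^ 2 * u + P * (- (ℕ→ℚ 2 + E) * (X ^ 2 * u * a)))
          + (u * (- ℕ→ℚ 2 * P * X - ℕ→ℚ 2 * P ^ 2 * E)) * (X * a - 1ℚ)
      lem₁ = solve-∀ ℚ-ring
      lem₂ : ∀ x y → x + y * (1ℚ - 1ℚ) ≡ x
      lem₂ = solve-∀ ℚ-ring
      Z : ℚ
      Z = X ^ 2 * u + P * (- (ℕ→ℚ 2 + E) * (X ^ 2 * u * a))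
      conclude : Y ^ 2 * (y - (u + P * (- E * (u * a)))) + P ^ 2 * r
        ≡ Y ^ (2 ℕ.+ e) - (X ^ (2 ℕ.+ e) + P * (- ℕ→ℚ (2 ℕ.+ e) * (X ^ (2 ℕ.+ e) * a)))
      conclude = begin
        Y ^ 2 * (y - (u + P * (- E * (u * a)))) + P ^ 2 * r
          ≡⟨ cong (λ z → z ^ 2 * (y - (u + P * (- E * (u * a)))) + P ^ 2 * r) Y≡ ⟩
        (P - X) ^ 2 * (y - (u + P * (- E * (u * a)))) + P ^ 2 * r
          ≡⟨ lem₁ P X a E u y ⟩
        (P - X) ^ 2 * y - Z + (u * (- ℕ→ℚ 2 * P * X - ℕ→ℚ 2 * P ^ 2 * E)) * (X * a - 1ℚ)
          ≡⟨ cong₂ (λ z t → z ^ 2 * y - Z + (u * (- ℕ→ℚ 2 * P * X - ℕ→ℚ 2 * P ^ 2 * E)) * (t - 1ℚ)) (sym Y≡) Xa ⟩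
        Y ^ 2 * y - Z + (u * (- ℕ→ℚ 2 * P * X - ℕ→ℚ 2 * P ^ 2 * E)) * (1ℚ - 1ℚ)
          ≡⟨ lem₂ (Y ^ 2 * y - Z) (u * (- ℕ→ℚ 2 * P * X - ℕ→ℚ 2 * P ^ 2 * E)) ⟩
        Y ^ 2 * y - Z
          ≡⟨ cong₂ (λ s k → s - (X ^ 2 * u + P * (- k * (X ^ 2 * u * a)))) (sym (^-+ Y 2 e)) (sym (ℕ→ℚ-+ 2 e)) ⟩
        Y ^ (2 ℕ.+ e) - (X ^ 2 * u + P * (- ℕ→ℚ (2 ℕ.+ e) * (X ^ 2 * u * a)))
          ≡⟨ cong (λ s → Y ^ (2 ℕ.+ e) - (s + P * (- ℕ→ℚ (2 ℕ.+ e) * (s * a)))) (sym (^-+ X 2 e)) ⟩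
        Y ^ (2 ℕ.+ e) - (X ^ (2 ℕ.+ e) + P * (- ℕ→ℚ (2 ℕ.+ e) * (X ^ (2 ℕ.+ e) * a))) ∎

    S : ℚ
    S = powerSum m

    S-mod : Div 1 S
    S-mod = powerSum-mod (s ℕ.+ suc s) m<q

    -- `halves` with c = 2^(p-5) and the correction -(p-5) x^(p-6). By Fermat 16c = 2^(p-1) ≡ 1 and
    -- x^(p-6) ≡ x⁻⁵ modulo p, while -(p-5) ≡ 5. Replacing 16c by 1 costs nothing modulo p², since S
    -- is itself divisible by p.
    powerSum-half : Div 2 (ℕ→ℚ 30 * S + ℕ→ℚ 5 * P * T)
    powerSum-half = Div-resp conclude (Div-+ (Div-+ scaled (Div-scale (Integral-ℕ 2) (Div-* u-mod S-mod))) (Div-P _ rest))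
      where
      open ≡-Reasoning
      n : ℕ
      n = 2 ℕ.+ suc s
      f g : ℕ → ℚ
      f x = ℕ→ℚ x ^ m
      g x = - M * (ℕ→ℚ x ^ m * v x)
      c u T′ : ℚ
      c = ℕ→ℚ 2 ^ m
      u = ℕ→ℚ 16 * c
      T′ = Σ< n (λ i → ℕ→ℚ (suc i) ^ m * v (suc i))
      reflect : ∀ x y → suc x ℕ.+ suc y ≡ suc q → Div 2 (f (suc y) - (f (suc x) + P * g (suc x)))
      reflect x y x+y≡p = evenPower-reflect (Integral-ℕ (suc x))
          (Integral-v (subst (suc x ℕ.<_) x+y≡p (ℕ.m<m+n (suc x) (s≤s z≤n))))
        (v-inverse x) (Integral-ℕ (suc y)) (trans (lem (ℕ→ℚ (suc x)) (ℕ→ℚ (suc y)))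
            (cong (_- ℕ→ℚ (suc x)) (trans (sym (ℕ→ℚ-+ (suc x) (suc y))) (cong ℕ→ℚ x+y≡p)))) (suc s)
        where
        lem : ∀ X Y → Y ≡ X + Y - X
        lem = solve-∀ ℚ-ring
      f-double : ∀ x → f (suc x ℕ.+ suc x) ≡ c * f (suc x)
      f-double x = trans (cong (_^ m) (trans (ℕ→ℚ-+ (suc x) (suc x)) (lem (ℕ→ℚ (suc x)))))
          (^-distrib-* (ℕ→ℚ 2) (ℕ→ℚ (suc x)) m)
        where
        lem : ∀ X → X + X ≡ ℕ→ℚ 2 * X
        lem = solve-∀ ℚ-ring
      g-double : ∀ x → ℕ→ℚ 2 * g (suc x ℕ.+ suc x) ≡ c * g (suc x)
      g-double x = trans (cong₂ (λ y z → ℕ→ℚ 2 * (- M * (y * z))) (f-double x) (v-double x))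
          (lem M c (f (suc x)) (v (suc x)))
        where
        lem : ∀ M c y a → ℕ→ℚ 2 * (- M * (c * y * (½ * a))) ≡ c * (- M * (y * a))
        lem = solve-∀ ℚ-ring
      u-mod : Div 1 (u - 1ℚ)
      u-mod = Div-resp (cong (_- 1ℚ) (^-+ (ℕ→ℚ 2) 4 m)) (fermat-unit {1} (s≤s (s≤s z≤n)))
      Integral-T′ : Integral T′
      Integral-T′ = Integral-Σ n λ i i<n → Integral-* (Integral-^ m (Integral-ℕ (suc i))) (Integral-v (s≤s (half<q i<n)))
      T-mod : Div 1 (T′ - T)
      T-mod = Div-Σ-cong n λ i i<n → Div-resp (lem (v (suc i)) (ℕ→ℚ (suc i) ^ m))
          (Div-scale (Integral-neg (Integral-v (s≤s (half<q i<n)))) (v^-mod 4 m refl (half<q i<n)))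
        where
        lem : ∀ a y → - a * (a ^ 4 - y) ≡ y * a - a ^ 5
        lem = solve-∀ ℚ-ring
      scaled : Div 2 (- (ℕ→ℚ 16) * (ℕ→ℚ 2 * (c - 1ℚ) * S - P * (c * Σ< n (g ∘ suc))))
      scaled = Div-scale (Integral-neg (Integral-ℕ 16)) (halves n half f g c (Integral-^ m (Integral-ℕ 2)) reflect
          f-double g-double)
      rest : Div 1 ((u - 1ℚ) * (M * T′) + M * (T′ - T) + P * T)
      rest = Div-+ (Div-+ (Div-resp (ℚ.*-comm (M * T′) (u - 1ℚ))
          (Div-scale (Integral-* (Integral-ℕ m) Integral-T′) u-mod)) (Div-scale (Integral-ℕ m) T-mod))
          (Div-P₁ Integral-T)
      lem₁ : ∀ P M S T T′ c → - (ℕ→ℚ 16) * (ℕ→ℚ 2 * (c - 1ℚ) * S - P * (c * (- M * T′))) + ℕ→ℚ 2 * ((ℕ→ℚ 16 * c - 1ℚ) * S)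
          + P * ((ℕ→ℚ 16 * c - 1ℚ) * (M * T′) + M * (T′ - T) + (ℕ→ℚ 5 + M) * T)
        ≡ ℕ→ℚ 30 * S + ℕ→ℚ 5 * P * T
      lem₁ = solve-∀ ℚ-ring
      conclude : - (ℕ→ℚ 16) * (ℕ→ℚ 2 * (c - 1ℚ) * S - P * (c * Σ< n (g ∘ suc))) + ℕ→ℚ 2 * ((u - 1ℚ) * S)
          + P * ((u - 1ℚ) * (M * T′) + M * (T′ - T) + P * T)
        ≡ ℕ→ℚ 30 * S + ℕ→ℚ 5 * P * T
      conclude = trans (cong₂ (λ t p → - (ℕ→ℚ 16) * (ℕ→ℚ 2 * (c - 1ℚ) * S - P * (c * t)) + ℕ→ℚ 2 * ((u - 1ℚ) * S)
          + P * ((u - 1ℚ) * (M * T′) + M * (T′ - T) + p * T)) (Σ-*ˡ n (- M) (λ i → ℕ→ℚ (suc i) ^ m * v (suc i)))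
              P≡5+M) (lem₁ P M S T T′ c)

    -- Five times `h₄-half` minus four times `powerSum-half` eliminates `T` and leaves 30(5h₄ - 4S);
    -- then S ≡ p B_(p-5).
    h₄-mod : Div 2 (ℕ→ℚ 5 * h 4 - ℕ→ℚ 4 * P * B m)
    h₄-mod = Div-resp (collect₂ P (h 4) S (B m)) (Div-+
      (Div-cancel {x = ℕ→ℚ 5 * h 4 - ℕ→ℚ 4 * S} (ℕ→ℚ 30) (½ * v 3 * v 5)
          (Integral-* (Integral-* Integral-½ Integral-⅓) Integral-⅕) refl
        (Div-resp (collect₁ P (h 4) S T) (Div-- (Div-scale (Integral-ℕ 5) h₄-half)
            (Div-scale (Integral-ℕ 4) powerSum-half))))
      (Div-scale (Integral-ℕ 4) (powerSum-mod² (s ℕ.+ suc s) m<q)))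
      where
      collect₁ : ∀ P h S T → ℕ→ℚ 5 * (ℕ→ℚ 30 * h + ℕ→ℚ 4 * P * T) - ℕ→ℚ 4 * (ℕ→ℚ 30 * S + ℕ→ℚ 5 * P * T) ≡ ℕ→ℚ 30 *
          (ℕ→ℚ 5 * h - ℕ→ℚ 4 * S)
      collect₁ = solve-∀ ℚ-ring
      collect₂ : ∀ P h S B → ℕ→ℚ 5 * h - ℕ→ℚ 4 * S + ℕ→ℚ 4 * (S - P * B) ≡ ℕ→ℚ 5 * h - ℕ→ℚ 4 * P * B
      collect₂ = solve-∀ ℚ-ring

  -- The double sum Z modulo p

  module DoubleSum (s : ℕ) (p-prime : Prime (5 ℕ.+ (suc s ℕ.+ suc s))) where
    open HalfSums s p-prime

    hBelow : ℕ → ℕ → ℚ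
    hBelow e j = Σ< j (λ i → v (suc i) ^ e)

    Integral-hBelow : ∀ e {j} → j ℕ.≤ q → Integral (hBelow e j)
    Integral-hBelow e {j} j≤q = Integral-Σ j λ i i<j → Integral-v^ e (ℕ.<-≤-trans i<j j≤q)

    -- The inner sum ends at 1/j² while the outer factor is 1/(j+1)³, so the two indices are
    -- strictly ordered.
    Z : ℚ
    Z = Σ< q (λ j → hBelow 2 j * v (suc j) ^ 3)

    Integral-Z : Integral Z
    Integral-Z = Integral-Σ q λ j j<q → Integral-* (Integral-hBelow 2 (ℕ.<⇒≤ j<q)) (Integral-v^ 3 j<q)

    h₁-mod : Div 1 (h 1)
    h₁-mod = h-mod 0 (2 ℕ.+ m) refl

    h₂-mod : Div 1 (h 2)
    h₂-mod = h-mod 1 (1 ℕ.+ m) refl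

    h₅-mod : Div 1 (h 5)
    h₅-mod = h-mod 4 (s ℕ.+ s) (arith s)
      where
      arith : ∀ s → 5 ℕ.+ suc (s ℕ.+ s) ≡ 4 ℕ.+ (suc s ℕ.+ suc s)
      arith = ℕ-solve-∀

    -- 1/i² is replaced by i^(p-3), whose sum over i < j is a polynomial in j by Faulhaber's formula;
    -- multiplied by 1/j³ and summed over j, only its coefficient with B_(p-5) survives modulo p.
    Z-mod : Div 1 (Z + ℕ→ℚ 2 * B m)
    Z-mod = Div-cancel (ℕ→ℚ 12) (½ * ½ * v 3) (Integral-* (Integral-* Integral-½ Integral-½) Integral-⅓) refl
      -- Modulo p, N ≡ -2 and 6·C(p-2, p-5) = (p-2)(p-3)(p-4) ≡ -24, so -12Y ≡ 6NY ≡ -6 β_m ≡ 24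
      -- B_m. Hence the factors 12 and -6.
      (Div-resp conclude (Div-+ (Div-+ (Div-scale (Integral-ℕ 12) Z-Y)
          (Div-scale (Integral-neg (Integral-ℕ 6)) NY-mod)) (Div-P₁ Integral-rest)))
      where
      open ≡-Reasoning
      N b : ℚ
      N = ℕ→ℚ (3 ℕ.+ m)
      b = B m
      β : ℕ → ℚ
      β k = binom (3 ℕ.+ m) k * B k
      -- With i running from 0 to j inclusive, Faulhaber's formula is a polynomial in j + 1, the
      -- same argument as in `v (suc j) ^ 3`.
      F : ℕ → ℚ
      F j = Σ< (suc j) (λ i → ℕ→ℚ i ^ (2 ℕ.+ m))
      -- The sum of (j+1)^(p-5-k). It is divisible by p for every k except k = p - 5, where all
      -- summands are 1 and the sum is p - 1.
      E : ℕ → ℚ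
      E k = Σ< q (λ j → ℕ→ℚ (suc j) ^ (3 ℕ.+ m ∸ k) * v (suc j) ^ 3)

      hBelow-mod : ∀ j → j ℕ.< q → Div 1 (hBelow 2 j - F j)
      hBelow-mod j j<q = Div-resp (cong (_-_ (hBelow 2 j)) (sym head))
        (Div-Σ-cong j λ i i<j → v^-mod 2 (2 ℕ.+ m) refl (ℕ.<-trans i<j j<q))
        where
        head : F j ≡ Σ< j (λ i → ℕ→ℚ (suc i) ^ (2 ℕ.+ m))
        head = trans (Σ-head j (λ i → ℕ→ℚ i ^ (2 ℕ.+ m))) (trans
            (cong (_+ Σ< j (λ i → ℕ→ℚ (suc i) ^ (2 ℕ.+ m))) (0^suc (suc m)))
          (ℚ.+-identityˡ (Σ< j (λ i → ℕ→ℚ (suc i) ^ (2 ℕ.+ m)))))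

      Y : ℚ
      Y = Σ< q (λ j → F j * v (suc j) ^ 3)

      Z-Y : Div 1 (Z - Y)
      Z-Y = Div-Σ-cong q λ j j<q → Div-resp (lem (hBelow 2 j) (F j) (v (suc j) ^ 3))
          (Div-scale (Integral-v^ 3 j<q) (hBelow-mod j j<q))
        where
        lem : ∀ x y z → z * (x - y) ≡ x * z - y * z
        lem = solve-∀ ℚ-ring

      NY≡ : N * Y ≡ Σ< (3 ℕ.+ m) (λ k → β k * E k)
      NY≡ = begin
        N * Y
          ≡⟨ sym (Σ-*ˡ q N (λ j → F j * v (suc j) ^ 3)) ⟩
        Σ< q (λ j → N * (F j * v (suc j) ^ 3))
          ≡⟨ Σ-ext q expand ⟩
        Σ< q (λ j → Σ< (3 ℕ.+ m) (λ k → β k * (ℕ→ℚ (suc j) ^ (3 ℕ.+ m ∸ k) * v (suc j) ^ 3)))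
          ≡⟨ Σ-swap q (3 ℕ.+ m) (λ j k → β k * (ℕ→ℚ (suc j) ^ (3 ℕ.+ m ∸ k) * v (suc j) ^ 3)) ⟩
        Σ< (3 ℕ.+ m) (λ k → Σ< q (λ j → β k * (ℕ→ℚ (suc j) ^ (3 ℕ.+ m ∸ k) * v (suc j) ^ 3)))
          ≡⟨ Σ-ext (3 ℕ.+ m) (λ k → Σ-*ˡ q (β k) (λ j → ℕ→ℚ (suc j) ^ (3 ℕ.+ m ∸ k) * v (suc j) ^ 3)) ⟩
        Σ< (3 ℕ.+ m) (λ k → β k * E k) ∎
        where
        expand : ∀ j → N * (F j * v (suc j) ^ 3) ≡ Σ< (3 ℕ.+ m) (λ k → β k * (ℕ→ℚ (suc j) ^ (3 ℕ.+ m ∸ k) * v (suc j) ^ 3))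
        expand j = begin
          N * (F j * V)
            ≡⟨ lem₁ N (F j) V ⟩
          V * (N * F j)
            ≡⟨ cong (V *_) (faulhaber (2 ℕ.+ m) (suc j)) ⟩
          V * Σ< (3 ℕ.+ m) (λ k → β k * ℕ→ℚ (suc j) ^ (3 ℕ.+ m ∸ k))
            ≡⟨ sym (Σ-*ˡ (3 ℕ.+ m) V (λ k → β k * ℕ→ℚ (suc j) ^ (3 ℕ.+ m ∸ k))) ⟩
          Σ< (3 ℕ.+ m) (λ k → V * (β k * ℕ→ℚ (suc j) ^ (3 ℕ.+ m ∸ k)))
            ≡⟨ Σ-ext (3 ℕ.+ m) (λ k → lem₂ V (β k) (ℕ→ℚ (suc j) ^ (3 ℕ.+ m ∸ k))) ⟩
          Σ< (3 ℕ.+ m) (λ k → β k * (ℕ→ℚ (suc j) ^ (3 ℕ.+ m ∸ k) * V)) ∎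
          where
          V : ℚ
          V = v (suc j) ^ 3
          lem₁ : ∀ n f v → n * (f * v) ≡ v * (n * f)
          lem₁ = solve-∀ ℚ-ring
          lem₂ : ∀ v b x → v * (b * x) ≡ b * (x * v)
          lem₂ = solve-∀ ℚ-ring

      E-power : ∀ {i k} → 3 ℕ.+ m ∸ k ≡ 3 ℕ.+ i → E k ≡ powerSum i
      E-power {i} eq = Σ-ext q λ j → trans (cong (λ n → ℕ→ℚ (suc j) ^ n * v (suc j) ^ 3) eq) (^-inverse (v-inverse j) 3 i)

      E-low : ∀ k → k ℕ.< m → Div 1 (E k)
      E-low k k<m = Div-resp (sym (E-power {suc (m ∸ suc k)} {k}
          (trans (ℕ.+-∸-assoc 3 (ℕ.<⇒≤ k<m)) (cong (3 ℕ.+_) (ℕ.+-∸-assoc 1 k<m)))))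
        (powerSum-mod (m ∸ suc k) (ℕ.≤-<-trans (subst (ℕ._≤ m) (ℕ.+-∸-assoc 1 k<m) (ℕ.m∸n≤m m k)) m<q))

      E-m : E m ≡ P - 1ℚ
      E-m = trans (E-power {0} {m} (ℕ.m+n∸n≡m 3 m)) (trans (ones q) (trans (lem (ℕ→ℚ q)) (cong (_- 1ℚ) (sym (ℕ→ℚ-suc q)))))
        where
        ones : ∀ n → Σ< n (λ _ → 1ℚ) ≡ ℕ→ℚ n
        ones zero    = refl
        ones (suc n) = trans (cong (_+ 1ℚ) (ones n)) (trans (ℚ.+-comm (ℕ→ℚ n) 1ℚ) (sym (ℕ→ℚ-suc n)))
        lem : ∀ x → x ≡ 1ℚ + x - 1ℚ
        lem = solve-∀ ℚ-ring

      E-m+1 : E (1 ℕ.+ m) ≡ h 1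
      E-m+1 = Σ-ext q λ j → trans (cong (λ n → ℕ→ℚ (suc j) ^ n * v (suc j) ^ 3) (ℕ.m+n∸n≡m 2 m))
        (trans (lem (ℕ→ℚ (suc j)) (v (suc j))) (trans (cong (λ t → t ^ 2 * v (suc j)) (v-inverse j))
            (ℚ.*-identityˡ (v (suc j)))))
        where
        lem : ∀ x y → x ^ 2 * y ^ 3 ≡ (x * y) ^ 2 * y
        lem = solve-∀ ℚ-ring

      E-m+2 : E (2 ℕ.+ m) ≡ h 2
      E-m+2 = Σ-ext q λ j → trans (cong (λ n → ℕ→ℚ (suc j) ^ n * v (suc j) ^ 3) (ℕ.m+n∸n≡m 1 m))
        (trans (lem (ℕ→ℚ (suc j)) (v (suc j))) (trans (cong (λ t → t * v (suc j) ^ 2) (v-inverse j))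
            (ℚ.*-identityˡ (v (suc j) ^ 2))))
        where
        lem : ∀ x y → x ^ 1 * y ^ 3 ≡ x * y * y ^ 2
        lem = solve-∀ ℚ-ring

      Integral-β : ∀ k → k ℕ.< q → Integral (β k)
      Integral-β k k<q = Integral-faulhaberTerm k k<q

      NY-mod : Div 1 (N * Y - β m * (P - 1ℚ))
      NY-mod = Div-resp (sym (trans (cong (_- β m * (P - 1ℚ)) NY≡) (trans
          (cong (λ t → Σ< m (λ k → β k * E k) + β m * t + β (1 ℕ.+ m) * E (1 ℕ.+ m) + β (2 ℕ.+ m) * E (2 ℕ.+ m) - β
              m * (P - 1ℚ)) E-m)
          (lem (Σ< m (λ k → β k * E k)) (β m * (P - 1ℚ)) (β (1 ℕ.+ m) * E (1 ℕ.+ m)) (β (2 ℕ.+ m) * E (2 ℕ.+ m))))))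
        (Div-+ (Div-+ (Div-Σ m λ k k<m → Div-scale (Integral-β k (ℕ.<-trans k<m m<q)) (E-low k k<m))
          (Div-scale (Integral-β (1 ℕ.+ m) (s≤s (s≤s (ℕ.m≤n+m m 2)))) (Div-resp (sym E-m+1) h₁-mod)))
          (Div-scale (Integral-β (2 ℕ.+ m) (s≤s (s≤s (s≤s (ℕ.m≤n+m m 1))))) (Div-resp (sym E-m+2) h₂-mod)))
        where
        lem : ∀ x y z w → x + y + z + w - y ≡ x + z + w
        lem = solve-∀ ℚ-ring

      R : ℚ
      -- The quotient of (p-1)(p-2)(p-3)(p-4) - 24 by p.
      R = P ^ 3 - ℕ→ℚ 10 * P ^ 2 + ℕ→ℚ 35 * P - ℕ→ℚ 50

      Integral-rest : Integral (ℕ→ℚ 6 * Y - R * b)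
      Integral-rest = Integral-- (Integral-* (Integral-ℕ 6) (subst Integral (lem Z Y)
          (Integral-- Integral-Z (Div⇒Integral Z-Y))))
        (Integral-* (Integral-- (Integral-+ (Integral-- (Integral-^ 3 iP)
            (Integral-* (Integral-ℕ 10) (Integral-^ 2 iP))) (Integral-* (Integral-ℕ 35) iP)) (Integral-ℕ 50))
          (Integral-B m m<q))
        where
        lem : ∀ z y → z - (z - y) ≡ y
        lem = solve-∀ ℚ-ring

      conclude : ℕ→ℚ 12 * (Z - Y) + - ℕ→ℚ 6 * (N * Y - β m * (P - 1ℚ)) + P * (ℕ→ℚ 6 * Y - R * b) ≡ ℕ→ℚ 12 * (Z + ℕ→ℚ 2 * b)
      conclude = begin
        ℕ→ℚ 12 * (Z - Y) + - ℕ→ℚ 6 * (N * Y - β m * (P - 1ℚ)) + P * (ℕ→ℚ 6 * Y - R * b)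
          ≡⟨ lem₁ P N Y Z (binom (3 ℕ.+ m) m) b R ⟩
        ℕ→ℚ 12 * (Z - Y) - ℕ→ℚ 6 * (N * Y) + ℕ→ℚ 6 * binom (3 ℕ.+ m) m * b * (P - 1ℚ) + P * (ℕ→ℚ 6 * Y - R * b)
          ≡⟨ cong (λ t → ℕ→ℚ 12 * (Z - Y) - ℕ→ℚ 6 * (N * Y) + t * b * (P - 1ℚ) + P * (ℕ→ℚ 6 * Y - R * b)) (binom-3rd m) ⟩
        ℕ→ℚ 12 * (Z - Y) - ℕ→ℚ 6 * (N * Y) + N * (ℕ→ℚ (2 ℕ.+ m) * ℕ→ℚ (1 ℕ.+ m)) * b * (P - 1ℚ) + P * (ℕ→ℚ 6 * Y - R * b)
          ≡⟨ cong₂ (λ n k → ℕ→ℚ 12 * (Z - Y) - ℕ→ℚ 6 * (n * Y) + n * (k * ℕ→ℚ (1 ℕ.+ m)) * b * (P - 1ℚ) + P *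
              (ℕ→ℚ 6 * Y - R * b)) (shift 2 3 refl) (shift 3 2 refl) ⟩
        ℕ→ℚ 12 * (Z - Y) - ℕ→ℚ 6 * ((P - ℕ→ℚ 2) * Y) + (P - ℕ→ℚ 2) * ((P - ℕ→ℚ 3) * ℕ→ℚ (1 ℕ.+ m)) * b * (P - 1ℚ) +
            P * (ℕ→ℚ 6 * Y - R * b)
          ≡⟨ cong (λ k → ℕ→ℚ 12 * (Z - Y) - ℕ→ℚ 6 * ((P - ℕ→ℚ 2) * Y) + (P - ℕ→ℚ 2) * ((P - ℕ→ℚ 3) * k) * b *
              (P - 1ℚ) + P * (ℕ→ℚ 6 * Y - R * b)) (shift 4 1 refl) ⟩
        ℕ→ℚ 12 * (Z - Y) - ℕ→ℚ 6 * ((P - ℕ→ℚ 2) * Y) + (P - ℕ→ℚ 2) * ((P - ℕ→ℚ 3) * (P - ℕ→ℚ 4)) * b * (P - 1ℚ) + P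
            * (ℕ→ℚ 6 * Y - R * b)
          ≡⟨ lem₂ P Y Z b ⟩
        ℕ→ℚ 12 * (Z + ℕ→ℚ 2 * b) ∎
        where
        shift : ∀ d k → d ℕ.+ k ≡ 5 → ℕ→ℚ (k ℕ.+ m) ≡ P - ℕ→ℚ d
        shift d k d+k≡5 = trans (lem (ℕ→ℚ d) (ℕ→ℚ (k ℕ.+ m)))
          (cong (_- ℕ→ℚ d) (trans (sym (ℕ→ℚ-+ d (k ℕ.+ m))) (cong ℕ→ℚ
              (trans (sym (ℕ.+-assoc d k m)) (cong (ℕ._+ m) d+k≡5)))))
          where
          lem : ∀ x y → y ≡ x + y - x
          lem = solve-∀ ℚ-ring
        lem₁ : ∀ P N Y Z c b R → ℕ→ℚ 12 * (Z - Y) + - ℕ→ℚ 6 * (N * Y - c * b * (P - 1ℚ)) + P * (ℕ→ℚ 6 * Y - R * b)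
          ≡ ℕ→ℚ 12 * (Z - Y) - ℕ→ℚ 6 * (N * Y) + ℕ→ℚ 6 * c * b * (P - 1ℚ) + P * (ℕ→ℚ 6 * Y - R * b)
        lem₁ = solve-∀ ℚ-ring
        lem₂ : ∀ P Y Z b → ℕ→ℚ 12 * (Z - Y) - ℕ→ℚ 6 * ((P - ℕ→ℚ 2) * Y) + (P - ℕ→ℚ 2) * ((P - ℕ→ℚ 3) * (P - ℕ→ℚ 4))
            * b * (P - 1ℚ)
            + P * (ℕ→ℚ 6 * Y - (P ^ 3 - ℕ→ℚ 10 * P ^ 2 + ℕ→ℚ 35 * P - ℕ→ℚ 50) * b)
          ≡ ℕ→ℚ 12 * (Z + ℕ→ℚ 2 * b)
        lem₂ = solve-∀ ℚ-ring

  -- Collecting the congruences modulo p⁹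

  module Assembly (s : ℕ) (p-prime : Prime (5 ℕ.+ (suc s ℕ.+ suc s))) where
    open HalfSums s p-prime
    open DoubleSum s p-prime

    -- The product of (1 - p²/i²)² is exp(-2p²h₂ - p⁴h₄ - ...), with h₂ and h₄ summed up to j; `W`
    -- is its expansion through p⁴.
    W : ℕ → ℚ
    W j = 1ℚ - ℕ→ℚ 2 * P ^ 2 * hBelow 2 j + P ^ 4 * (ℕ→ℚ 2 * hBelow 2 j ^ 2 - hBelow 4 j)

    w²-mod⁶ : ∀ j → j ℕ.≤ q → Div 6 (w P j ^ 2 - W j)
    w²-mod⁶ zero    j≤q = Div-resp (lem P) Div-0
      where
      lem : ∀ P → 0ℚ ≡ 1ℚ ^ 2 - (1ℚ - ℕ→ℚ 2 * P ^ 2 * 0ℚ + P ^ 4 * (ℕ→ℚ 2 * 0ℚ ^ 2 - 0ℚ))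
      lem = solve-∀ ℚ-ring
    w²-mod⁶ (suc j) j<q = Div-resp (lem P (v (suc j)) (w P j) (hBelow 2 j) (hBelow 4 j))
      (Div-+ (Div-scale (Integral-^ 2 (Integral-- (Integral-* (Integral-^ 2 iP) (Integral-^ 2 iV)) (Integral-ℕ 1)))
          (w²-mod⁶ j (ℕ.<⇒≤ j<q)))
        (Div-P^ 6 (Integral-- (Integral-* (Integral-* (Integral-- (Integral-* (Integral-^ 2 iP) (Integral-^ 4 iV))
            (Integral-* (Integral-ℕ 2) (Integral-^ 2 iV))) (Integral-ℕ 1))
          (Integral-- (Integral-* (Integral-ℕ 2) (Integral-^ 2 iH₂)) iH₄))
              (Integral-* (Integral-* (Integral-ℕ 2) (Integral-^ 4 iV)) iH₂))))
      where
      iV : Integral (v (suc j))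
      iV = Integral-v (s≤s j<q)
      iH₂ : Integral (hBelow 2 j)
      iH₂ = Integral-hBelow 2 (ℕ.<⇒≤ j<q)
      iH₄ : Integral (hBelow 4 j)
      iH₄ = Integral-hBelow 4 (ℕ.<⇒≤ j<q)
      lem : ∀ P V w x y →
        (P ^ 2 * V ^ 2 - 1ℚ) ^ 2 * (w ^ 2 - (1ℚ - ℕ→ℚ 2 * P ^ 2 * x + P ^ 4 * (ℕ→ℚ 2 * x ^ 2 - y)))
          + P ^ 6 * ((P ^ 2 * V ^ 4 - ℕ→ℚ 2 * V ^ 2) * 1ℚ * (ℕ→ℚ 2 * x ^ 2 - y) - ℕ→ℚ 2 * V ^ 4 * x)
        ≡ (w * (P ^ 2 * V ^ 2 - 1ℚ)) ^ 2 - (1ℚ - ℕ→ℚ 2 * P ^ 2 * (x + V ^ 2) + P ^ 4 *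
            (ℕ→ℚ 2 * (x + V ^ 2) ^ 2 - (y + V ^ 4)))
      lem = solve-∀ ℚ-ring

    -- Modulo p⁴ only 1 - 2p²h₂ remains of `W`; against 1/(j+1)³ these two terms sum to h₃ and Z.
    w²-sum-mod⁴ : Div 4 (Σ< q (λ j → w P j ^ 2 * v (suc j) ^ 3) - (h 3 + - (ℕ→ℚ 2 * P ^ 2) * Z))
    w²-sum-mod⁴ = Div-resp (cong (_-_ (Σ< q (λ j → w P j ^ 2 * v (suc j) ^ 3)))
        (Σ-linear q (- (ℕ→ℚ 2 * P ^ 2)) (λ j → v (suc j) ^ 3) (λ j → hBelow 2 j * v (suc j) ^ 3)))
      (Div-Σ-cong q λ j j<q → Div-resp (lem P (w P j) (hBelow 2 j) (hBelow 4 j) (v (suc j)))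
        (Div-scale (Integral-v^ 3 j<q) (Div-+ (Div-lower 2 (w²-mod⁶ j (ℕ.<⇒≤ j<q)))
          (Div-P^ 4 (Integral-- (Integral-* (Integral-ℕ 2) (Integral-^ 2 (Integral-hBelow 2 (ℕ.<⇒≤ j<q))))
              (Integral-hBelow 4 (ℕ.<⇒≤ j<q)))))))
      where
      lem : ∀ P w x y V → V ^ 3 * (w ^ 2 - (1ℚ - ℕ→ℚ 2 * P ^ 2 * x + P ^ 4 * (ℕ→ℚ 2 * x ^ 2 - y)) + P ^ 4 *
          (ℕ→ℚ 2 * x ^ 2 - y))
        ≡ w ^ 2 * V ^ 3 - (V ^ 3 + - (ℕ→ℚ 2 * P ^ 2) * (x * V ^ 3))
      lem = solve-∀ ℚ-ring

    X : ℚ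
    X = Σ< q (λ j → w P j ^ 2 * v (suc j) ^ 3)

    -- The expansion is p³ - 2p⁵h₂ + p⁶h₃ + p⁷(2h₂² - h₄) - 2p⁸Z. The relation for h₁ trades h₂ for
    -- 4p⁴h₁ and leaves 3p⁶h₃ + p⁷h₄ + 2p⁸h₅; the relation for h₃ turns this into -(7/2)p⁷h₄ -
    -- 7p⁸h₅. The terms with h₂² and h₅ vanish since p divides h₂ and h₅. Finally h₄ gives -14/5 and
    -- Z gives 4 times p⁸B_(p-5), and 4 - 14/5 = 6/5.
    main : Div 9 (P ^ 3 * w P q ^ 2 + P ^ 6 * X - (P ^ 3 + ℕ→ℚ 4 * P ^ 4 * h 1 + + 6 / 5 * P ^ 8 * B m))
    main = Div-resp (lem P (w P q) X (h 1) (h 2) (h 3) (h 4) (h 5) Z (B m))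
      (Div-- (Div-- (Div-- (Div-+ (Div-+ (Div-- (Div-+
        (Div-raise 3 (w²-mod⁶ q ℕ.≤-refl))
        (Div-lower 1 (Div-raise 6 w²-sum-mod⁴)))
        (Div-scale (Integral-ℕ 2) (Div-raise 4 h₁-relation)))
        (Div-scale (Integral-* (Integral-ℕ 3) Integral-½) (Div-raise 6 h₃-relation)))
        (Div-scale (Integral-ℕ 2) (Div-raise 7 (Div-* h₂-mod h₂-mod))))
        (Div-scale (Integral-ℕ 7) (Div-raise 8 h₅-mod)))
        (Div-scale (Integral-* (Integral-* (Integral-ℕ 7) Integral-½) Integral-⅕) (Div-raise 7 h₄-mod)))
        (Div-scale (Integral-ℕ 2) (Div-raise 8 Z-mod)))
      where
      lem : ∀ P w X h₁ h₂ h₃ h₄ h₅ Z b →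
        P ^ 3 * (w ^ 2 - (1ℚ - ℕ→ℚ 2 * P ^ 2 * h₂ + P ^ 4 * (ℕ→ℚ 2 * h₂ ^ 2 - h₄)))
          + P ^ 6 * (X - (h₃ + - (ℕ→ℚ 2 * P ^ 2) * Z))
          - ℕ→ℚ 2 * (P ^ 4 * (ℕ→ℚ 2 * h₁ + P * h₂ + P ^ 2 * h₃ + P ^ 3 * h₄ + P ^ 4 * h₅))
          + ℕ→ℚ 3 * ½ * (P ^ 6 * (ℕ→ℚ 2 * h₃ + ℕ→ℚ 3 * P * h₄ + ℕ→ℚ 6 * P ^ 2 * h₅))
          + ℕ→ℚ 2 * (P ^ 7 * (h₂ * h₂))
          - ℕ→ℚ 7 * (P ^ 8 * h₅)
          - ℕ→ℚ 7 * ½ * v 5 * (P ^ 7 * (ℕ→ℚ 5 * h₄ - ℕ→ℚ 4 * P * b))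
          - ℕ→ℚ 2 * (P ^ 8 * (Z + ℕ→ℚ 2 * b))
        ≡ P ^ 3 * w ^ 2 + P ^ 6 * X - (P ^ 3 + ℕ→ℚ 4 * P ^ 4 * h₁ + + 6 / 5 * P ^ 8 * b)
      lem = solve-∀ ℚ-ring

    H≡h : ∀ n → H n ≡ Σ< n (λ j → v (suc j) ^ 1)
    H≡h zero    = refl
    H≡h (suc n) = cong (_+ v (suc n)) (H≡h n)

    aperyTotal prediction : ℚ
    aperyTotal = Σ< (suc q) (λ k → ℕ→ℚ ((2 ℕ.* k ℕ.+ 1) ℕ^ 3 ℕ.* apery k))
    prediction = ℕ→ℚ (suc q ℕ^ 3) + (ℕ→ℚ 4 * ℕ→ℚ (suc q ℕ^ 4) * H q) + ((+ 6 / 5) * ℕ→ℚ (suc q ℕ^ 8) * B m)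

    congruence : CongMod (suc q) (ℕ→ℚ (suc q ℕ^ 9)) aperyTotal prediction
    congruence = Div⇒CongMod 9 {aperyTotal} {prediction} (Div-resp (sym (cong₂ _-_ total≡ prediction≡)) main)
      where
      lem : ∀ P w X V → P ^ 6 * (X + w ^ 2 * V ^ 3) ≡ P ^ 3 * w ^ 2 * (P * V) ^ 3 + P ^ 6 * X
      lem = solve-∀ ℚ-ring
      total≡ : aperyTotal ≡ P ^ 3 * w P q ^ 2 + P ^ 6 * X
      -- `X` ends at j = p - 2; the summand j = p - 1 contributes p⁶w²/p³.
      total≡ = trans (apery-sum q) (trans (lem P (w P q) X (v (suc q)))
        (cong (_+ P ^ 6 * X) (trans (cong (λ t → P ^ 3 * w P q ^ 2 * t ^ 3) (v-inverse q))
            (ℚ.*-identityʳ (P ^ 3 * w P q ^ 2)))))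
      prediction≡ : prediction ≡ P ^ 3 + ℕ→ℚ 4 * P ^ 4 * h 1 + + 6 / 5 * P ^ 8 * B m
      prediction≡ = cong₂ _+_ (cong₂ _+_ (ℕ→ℚ-^ (suc q) 3) (cong₂ (λ x y → ℕ→ℚ 4 * x * y) (ℕ→ℚ-^ (suc q) 4) (H≡h q)))
        (cong (λ x → + 6 / 5 * x * B m) (ℕ→ℚ-^ (suc q) 8))

-- The case p = 5 and the parity of p

even⊎odd : ∀ n → ∃ λ t → n ≡ t ℕ.+ t ⊎ n ≡ suc (t ℕ.+ t)
even⊎odd zero    = 0 , inj₁ refl
even⊎odd (suc n) with even⊎odd n
... | t , inj₁ n≡ = t , inj₂ (cong suc n≡)
... | t , inj₂ n≡ = suc t , inj₁ (trans (cong suc n≡) (cong suc (sym (ℕ.+-suc t t))))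

open import Data.Nat using (_^_)

-- Both sides are evaluated: their difference is 5⁹ · 37/3, with the denominator 3 coming from 4·H₄
-- = 25/3.
theorem-at-5 : CongMod 5 (ℕ→ℚ (5 ^ 9))
  (Σ< 5 (λ k → ℕ→ℚ ((2 ℕ.* k ℕ.+ 1) ^ 3 ℕ.* apery k)))
  (ℕ→ℚ (5 ^ 3) + (ℕ→ℚ 4 * ℕ→ℚ (5 ^ 4) * H 4) + ((+ 6 / 5) * ℕ→ℚ (5 ^ 8) * B 0))
theorem-at-5 = + 37 / 3 , toWitness {a? = coprime? 3 5} _ , refl

theorem1p2 : (p : ℕ) → Prime p → p ≥ 5 →
    CongMod p (ℕ→ℚ (p ^ 9))
    (Σ< p (λ k → ℕ→ℚ ((2 Data.Nat.* k Data.Nat.+ 1) ^ 3 Data.Nat.* apery k)))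
    (ℕ→ℚ (p ^ 3) + (ℕ→ℚ 4 * ℕ→ℚ (p ^ 4) * H (p ∸ 1)) + ((+ 6 / 5) * ℕ→ℚ (p ^ 8) * B (p ∸ 5)))
theorem1p2 p@(suc (suc (suc (suc (suc n))))) p-prime (s≤s (s≤s (s≤s (s≤s (s≤s z≤n))))) = byParity n p-prime (even⊎odd n)
  where
  double : ∀ t → 6 ℕ.+ (t ℕ.+ t) ≡ (3 ℕ.+ t) ℕ.* 2
  double = ℕ-solve-∀
  byParity : ∀ n → Prime (5 ℕ.+ n) → (∃ λ t → n ≡ t ℕ.+ t ⊎ n ≡ suc (t ℕ.+ t)) →
    CongMod (5 ℕ.+ n) (ℕ→ℚ ((5 ℕ.+ n) ^ 9))
    (Σ< (5 ℕ.+ n) (λ k → ℕ→ℚ ((2 ℕ.* k ℕ.+ 1) ^ 3 ℕ.* apery k)))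
    (ℕ→ℚ ((5 ℕ.+ n) ^ 3) + (ℕ→ℚ 4 * ℕ→ℚ ((5 ℕ.+ n) ^ 4) * H (4 ℕ.+ n)) + ((+ 6 / 5) * ℕ→ℚ ((5 ℕ.+ n) ^ 8) * B n))
  byParity n p-prime (zero  , inj₁ refl) = theorem-at-5
  byParity n p-prime (suc s , inj₁ refl) = Assembly.congruence s p-prime
  -- For odd n the number p = 5 + n is 2(3 + t), and its divisor 2 is neither 1 nor p.
  byParity n p-prime (t     , inj₂ refl) = contradiction (prime⇒irreducible p-prime {2}
      (divides (3 ℕ.+ t) (double t))) λ { (inj₁ ()) ; (inj₂ ()) }
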